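{- For every integer $n\ge1$, the generating function of even-order OSASMs satisfies \[ X^{\mathrm O}_{2n}(r,t)=t^{2n+2}\,X^{\mathrm O}_{2n}(r,t^{ -1}) \] as Laurent polynomials in the indeterminates $r,t$.
   Context: An alternating sign matrix (ASM) is a square matrix with entries in $\{ -1,0,1\}$ such that in each row and each column the nonzero entries alternate in sign and sum to $1$. A diagonally symmetric ASM (DSASM) is a symmetric ASM. An off-diagonally symmetric ASM (OSASM) of even order is a DSASM of even order all of whose diagonal entries are $0$; $\mathrm{OSASM}(2n)$ denotes the set of these of order $2n$. For such $A$, $R(A)=\sum_{1\le i<j\le 2n}|A_{i,j}|$ and $T(A)$ is the column index of the unique $1$ in the first row of $A$. Define $X^{\mathrm O}_{2n}(r,t)=\sum_{A\in\mathrm{OSASM}(2n)}r^{R(A)}t^{T(A)}$. -}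

module Defs where

open import Data.Nat as ℕ using (ℕ; zero; suc)
open import Data.Integer as ℤ using (ℤ; +_; -[1+_]; 0ℤ; 1ℤ)
open import Data.Fin using (Fin; toℕ)
open import Data.Vec as V using (Vec; []; _∷_; lookup; transpose)
open import Data.List as L using (List; []; _∷_; filter; length; concatMap; map; allFin)
open import Data.Bool using (Bool; true; false; _∧_; _∨_; if_then_else_)
open import Relation.Nullary.Decidable using (⌊_⌋; ¬?)
open import Data.Nat.ListAction using () renaming (sum to sumℕ)

Matrix : ℕ → Set
Matrix m = Vec (Vec ℤ m) m

entry : ∀ {m} → Matrix m → Fin m → Fin m → ℤ
entry A i j = lookup (lookup A i) j

_==_ : ℤ → ℤ → Bool
x == y = ⌊ x ℤ.≟ y ⌋

allB : {A : Set} → (A → Bool) → List A → Bool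
allB p [] = true
allB p (x ∷ xs) = p x ∧ allB p xs

isEntry : ℤ → Bool
isEntry x = (x == -[1+ 0 ]) ∨ (x == 0ℤ) ∨ (x == 1ℤ)

nonzeros : List ℤ → List ℤ
nonzeros = filter (λ x → ¬? (x ℤ.≟ 0ℤ))

alternates : List ℤ → Bool
alternates [] = true
alternates (x ∷ []) = true
alternates (x ∷ y ∷ xs) = ⌊ (x ℤ.* y) ℤ.<? 0ℤ ⌋ ∧ alternates (y ∷ xs)

sumℤ : List ℤ → ℤ
sumℤ = L.foldr ℤ._+_ 0ℤ

isASMLine : List ℤ → Bool
isASMLine l = allB isEntry l ∧ alternates (nonzeros l) ∧ (sumℤ (nonzeros l) == 1ℤ)

isASM : ∀ {m} → Matrix m → Bool
isASM A = allB (λ r → isASMLine (V.toList r)) (V.toList A)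
        ∧ allB (λ c → isASMLine (V.toList c)) (V.toList (transpose A))

isSymmetric : ∀ {m} → Matrix m → Bool
isSymmetric {m} A = allB (λ i → allB (λ j → entry A i j == entry A j i) (allFin m)) (allFin m)

zeroDiagonal : ∀ {m} → Matrix m → Bool
zeroDiagonal {m} A = allB (λ i → entry A i i == 0ℤ) (allFin m)

isOSASM : ∀ {m} → Matrix m → Bool
isOSASM A = isASM A ∧ isSymmetric A ∧ zeroDiagonal A

vecsOver : {A : Set} → List A → (m : ℕ) → List (Vec A m)
vecsOver xs zero = [] ∷ []
vecsOver xs (suc m) = concatMap (λ x → map (x ∷_) (vecsOver xs m)) xs

entries : List ℤ
entries = -[1+ 0 ] ∷ 0ℤ ∷ 1ℤ ∷ []

allMatrices : (m : ℕ) → List (Matrix m)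
allMatrices m = vecsOver (vecsOver entries m) m

-- OSASM(m), as a list (each matrix appears exactly once)
OSASMs : (m : ℕ) → List (Matrix m)
OSASMs m = L.filterᵇ isOSASM (allMatrices m)

R : ∀ {m} → Matrix m → ℕ
R {m} A = sumℕ (concatMap (λ i → map (λ j → ℤ.∣ entry A i j ∣)
                                      (filterᵇ (λ j → ⌊ toℕ i ℕ.<? toℕ j ⌋) (allFin m)))
                           (allFin m))
  where open L using (filterᵇ)

-- 1-based position of the first entry equal to 1 in a list
-- (for an ASM row this is the unique 1)
posOfOne : List ℤ → ℕ
posOfOne [] = 0
posOfOne (x ∷ xs) = if x == 1ℤ then 1 else suc (posOfOne xs)

T : ∀ {m} → Matrix m → ℕ
T [] = 0
T (r ∷ _) = posOfOne (V.toList r)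

-- Laurent polynomials in r, t with integer coefficients, represented by
-- their coefficient functions: p a k = coefficient of r^a t^k.

Laurent₂ : Set
Laurent₂ = ℤ → ℤ → ℤ

invT : Laurent₂ → Laurent₂
invT p a k = p a (ℤ.- k)

mulTPow : ℕ → Laurent₂ → Laurent₂
mulTPow e p a k = p a (k ℤ.- + e)

-- X^O_m(r,t) = Σ_{A ∈ OSASM(m)} r^{R(A)} t^{T(A)}; its coefficient of r^a t^k
-- is the number of A ∈ OSASM(m) with R(A) = a and T(A) = k.
XO : ℕ → Laurent₂
XO m a k = + length (L.filterᵇ (λ A → ((+ R A) == a) ∧ ((+ T A) == k)) (OSASMs m))

-- Reading partial sums down column i to the diagonal and then along row i turns an OSASM into a
-- configuration of lines: line i enters in state 0, leaves in state 1 and crosses every other line once.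
-- A zero entry leaves both states unchanged, an entry ±1 flips two equal states.  Weight the crossings as
-- in the six-vertex model, with parameters (x , z) on the lines.  By the Yang–Baxter equation the
-- partition function Z is symmetric in the lines, and if the entry state of line k is changed to 1, the
-- resulting functions E k satisfy exchange relations in k.  Inverting all the parameters swaps the weights
-- a and b.  Since E first = ∏ b · Z and E last = ∏ a · Z with one line less, induction on the number of lines
-- shows that Z is unchanged by inversion, and that E is unchanged by inversion combined with reversal of
-- the order of the lines.  At equal parameters E k counts, by R, the OSASMs with T = k + 1, so this
-- reversal is the theorem.
--
-- The exchange relations degenerate at equal parameters.  Instead, all parameters are taken distinct and
-- congruent to 1 modulo arbitrarily large integers, and r = p + 1/p is handled by letting the integer p vary.

module Submission where

open import Defs
open import Data.Bool using (Bool; true; false; if_then_else_; _∧_)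
open import Data.Bool.Properties using (∧-zeroʳ; ∧-assoc; ∧-comm; ∧-idem)
open import Data.Empty using (⊥-elim)
open import Data.Fin using (Fin; zero; suc; toℕ)
open import Data.Integer hiding (suc)
open import Data.Integer.Properties
open import Data.Integer.Tactic.RingSolver using (solve-∀; solve)
open import Data.List
  using (List; []; _∷_; _++_; [_]; _ʳ++_; allFin; concatMap; filterᵇ; length; map; reverse; upTo)
open import Data.List.Properties
  using (++-identityʳ; concatMap-cong; concatMap-map; length-map; length-reverse; length-upTo; length-ʳ++;
         map-cong; map-tabulate; map-∘; map-ʳ++; reverse-map; ʳ++-defn; ʳ++-ʳ++)
open import Data.List.Relation.Binary.Permutation.Propositional
  using (_↭_; refl; prep; ↭-refl; ↭-sym; ↭-trans; ↭-reflexive) renaming (swap to ↭swap; trans to ↭then)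
open import Data.List.Relation.Binary.Permutation.Propositional.Properties using (All-resp-↭; ↭-reverse)
import Data.List.Relation.Unary.All as All
import Data.List.Relation.Unary.All.Properties as All
import Data.List.Relation.Unary.AllPairs as AllPairs
import Data.List.Relation.Unary.AllPairs.Properties as AllPairs
open import Data.List.Relation.Unary.Unique.Propositional.Properties using (upTo⁺)
open import Data.Maybe using (Maybe; just; nothing; maybe)
open import Data.Nat as ℕ using (ℕ; zero; suc; z≤n; s≤s)
open import Data.Nat.ListAction using (sum)
open import Data.Nat.ListAction.Properties using (sum-++)
import Data.Nat.Properties as ℕ
open import Data.Product using (_×_; _,_; ∃; swap)
open import Data.Sum using (_⊎_; inj₁; inj₂)
import Data.Vec as Vec
import Data.Vec.Properties as Vec
open import Algebra.Properties.AbelianGroup +-0-abelianGroup using () renaming (∙-cancelˡ to +-cancelˡ)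
open import Function using (_∘_; const; id)
open import Relation.Binary.Definitions using (Symmetric)
open import Relation.Binary.PropositionalEquality hiding ([_])
open import Relation.Nullary using (Dec; yes; no; contradiction)
open import Relation.Nullary.Decidable using (isYes≗does; ⌊_⌋)

-- The two inductions interlock. Invariance of `Z` for k lines gives the relation for `E` with k + 1
-- lines. For k + 2 lines, the first line enters in state 0, meets only lines in state 0 and flips
-- exactly once; expanding at that flip expresses `Z` through `E` with k + 1 lines. The crossings
-- before the flip have weight `a` and those after it weight `b`, which is why inversion has to be
-- combined with reversal.
--
-- Permuting the lines in `Z` divides by `A`, and moving the mark in `E` divides by `B`, which
-- vanishes at equal parameters. All parameters are integers, so nonvanishing is a matter of
-- divisibility: the modulus is a multiple of p, which keeps `A` congruent to -1 modulo p, and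
-- distinctness keeps `B` nonzero. A difference at equal parameters that is divisible by arbitrarily
-- large integers is 0.
--
-- The same principle separates the powers of r. Cleared of denominators, r is `C` over `d`, where p
-- divides `d` and is prime to `C`; a polynomial vanishing there has a leading coefficient divisible
-- by p, and p is arbitrary.

private variable
  W X Y : Set

-- Vertex weights and the local form of the Yang-Baxter equation

Param : Set
Param = ℤ × ℤ

unit : Param
unit = 1ℤ , 1ℤ

-- Certificates for consequences of equations: each hypothesis enters with an explicit cofactor `k`,
-- and what remains is a ring identity for the solver.
linear-combination : ∀ {X Y l r} k → l ≡ r → X ≡ Y + k * (l - r) → X ≡ Y
linear-combination {Y = Y} {r = r} k refl e = trans e (lem k r Y)
  where
  lem : ∀ k r Y → Y + k * (r - r) ≡ Y
  lem = solve-∀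

-- The eight entries of the Yang–Baxter equation for a line t that crosses y and then z, of which two are
-- trivial.  The names list the states of t, y and z before the crossings; fᵢ and gᵢ stand for the values
-- after them, for the two orders of y and z.
module LocalExchange (A B C a₁ a₂ b₁ b₂ nt ny nz : ℤ)
  (a-relation  : A * a₁ ≡ C * ny * a₂ + B * b₁)
  (b-relation  : A * b₂ ≡ C * nz * b₁ + B * a₂)
  (ab-relation : a₁ * b₂ ≡ b₁ * a₂ + B * (C * nt))
  where

  local-fff : ∀ f₀ f₁ f₂ g₀ g₁ g₂ →
    A * g₀ ≡ A * f₀ → A * g₁ ≡ C * ny * f₁ + B * f₂ → A * g₂ ≡ C * nz * f₂ + B * f₁ →
    A * (a₂ * (a₁ * g₀ + C * g₁) + C * (b₁ * g₂)) ≡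
    A * (a₁ * (a₂ * f₀ + C * f₁) + C * (b₂ * f₂))
  local-fff f₀ f₁ f₂ g₀ g₁ g₂ e₀ e₁ e₂ =
    linear-combination (a₂ * a₁) e₀ (
    linear-combination (a₂ * C) e₁ (
    linear-combination (C * b₁) e₂ (
    linear-combination (- (C * f₁)) a-relation (
    linear-combination (- (C * f₂)) b-relation (
    solve (A ∷ B ∷ C ∷ a₁ ∷ a₂ ∷ b₁ ∷ b₂ ∷ nt ∷ ny ∷ nz ∷ f₀ ∷ f₁ ∷ f₂ ∷ g₀ ∷ g₁ ∷ g₂ ∷ []))))))

  local-ftf : ∀ f₀ f₁ f₂ g₀ g₁ →
    A * g₁ ≡ C * nz * f₁ + B * f₂ → A * g₀ ≡ A * f₀ →
    A * (b₂ * (a₁ * g₁ + C * g₀)) ≡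
    C * nz * (b₁ * (a₂ * f₁ + C * f₀)) + B * (a₁ * (b₂ * f₂) + C * (a₂ * f₀ + C * (nt * nz) * f₁))
  local-ftf f₀ f₁ f₂ g₀ g₁ e₀ e₁ =
    linear-combination (b₂ * a₁) e₀ (
    linear-combination (b₂ * C) e₁ (
    linear-combination (C * nz * f₁) ab-relation (
    linear-combination (C * f₀) b-relation (
    solve (A ∷ B ∷ C ∷ a₁ ∷ a₂ ∷ b₁ ∷ b₂ ∷ nt ∷ ny ∷ nz ∷ f₀ ∷ f₁ ∷ f₂ ∷ g₀ ∷ g₁ ∷ [])))))

  local-fft : ∀ f₀ f₁ f₂ g₀ g₁ g₂ →
    A * g₂ ≡ C * ny * f₂ + B * f₁ → A * g₀ ≡ A * f₀ → A * g₁ ≡ C * nz * f₁ + B * f₂ →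
    A * (a₂ * (b₁ * g₂) + C * (a₁ * g₀ + C * (nt * ny) * g₁)) ≡
    C * ny * (a₁ * (b₂ * f₂) + C * (a₂ * f₀ + C * (nt * nz) * f₁)) + B * (b₁ * (a₂ * f₁ + C * f₀))
  local-fft f₀ f₁ f₂ g₀ g₁ g₂ e₀ e₁ e₂ =
    linear-combination (a₂ * b₁) e₀ (
    linear-combination (C * a₁) e₁ (
    linear-combination (C * (C * (nt * ny))) e₂ (
    linear-combination (C * f₀) a-relation (
    linear-combination (- (C * ny * f₂)) ab-relation (
    solve (A ∷ B ∷ C ∷ a₁ ∷ a₂ ∷ b₁ ∷ b₂ ∷ nt ∷ ny ∷ nz ∷ f₀ ∷ f₁ ∷ f₂ ∷ g₀ ∷ g₁ ∷ g₂ ∷ []))))))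

  local-ttf : ∀ f₀ f₁ f₂ g₀ g₁ g₂ →
    A * g₁ ≡ C * nz * f₁ + B * f₂ → A * g₀ ≡ A * f₀ → A * g₂ ≡ C * ny * f₂ + B * f₁ →
    A * (a₂ * (b₁ * g₁) + C * (nt * nz) * (a₁ * g₀ + C * g₂)) ≡
    C * nz * (a₁ * (b₂ * f₁) + C * (nt * ny) * (a₂ * f₀ + C * f₂)) + B * (b₁ * (a₂ * f₂ + C * (nt * nz) * f₀))
  local-ttf f₀ f₁ f₂ g₀ g₁ g₂ e₀ e₁ e₂ =
    linear-combination (a₂ * b₁) e₀ (
    linear-combination (C * (nt * nz) * a₁) e₁ (
    linear-combination (C * (nt * nz) * C) e₂ (
    linear-combination (- (C * nz * f₁)) ab-relation (
    linear-combination (C * (nt * nz) * f₀) a-relation (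
    solve (A ∷ B ∷ C ∷ a₁ ∷ a₂ ∷ b₁ ∷ b₂ ∷ nt ∷ ny ∷ nz ∷ f₀ ∷ f₁ ∷ f₂ ∷ g₀ ∷ g₁ ∷ g₂ ∷ []))))))

  local-tft : ∀ f₀ f₁ f₂ g₀ g₂ →
    A * g₂ ≡ C * ny * f₂ + B * f₁ → A * g₀ ≡ A * f₀ →
    A * (b₂ * (a₁ * g₂ + C * (nt * ny) * g₀)) ≡
    C * ny * (b₁ * (a₂ * f₂ + C * (nt * nz) * f₀)) + B * (a₁ * (b₂ * f₁) + C * (nt * ny) * (a₂ * f₀ + C * f₂))
  local-tft f₀ f₁ f₂ g₀ g₂ e₀ e₁ =
    linear-combination (b₂ * a₁) e₀ (
    linear-combination (b₂ * (C * (nt * ny))) e₁ (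
    linear-combination (C * ny * f₂) ab-relation (
    linear-combination (C * (nt * ny) * f₀) b-relation (
    solve (A ∷ B ∷ C ∷ a₁ ∷ a₂ ∷ b₁ ∷ b₂ ∷ nt ∷ ny ∷ nz ∷ f₀ ∷ f₁ ∷ f₂ ∷ g₀ ∷ g₂ ∷ [])))))

  local-ttt : ∀ f₀ f₁ f₂ g₀ g₁ g₂ →
    A * g₀ ≡ A * f₀ → A * g₁ ≡ C * nz * f₁ + B * f₂ → A * g₂ ≡ C * ny * f₂ + B * f₁ →
    A * (a₂ * (a₁ * g₀ + C * (nt * ny) * g₁) + C * (nt * nz) * (b₁ * g₂)) ≡
    A * (a₁ * (a₂ * f₀ + C * (nt * nz) * f₁) + C * (nt * ny) * (b₂ * f₂))
  local-ttt f₀ f₁ f₂ g₀ g₁ g₂ e₀ e₁ e₂ =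
    linear-combination (a₂ * a₁) e₀ (
    linear-combination (a₂ * (C * (nt * ny))) e₁ (
    linear-combination (C * (nt * nz) * b₁) e₂ (
    linear-combination (- (C * (nt * nz) * f₁)) a-relation (
    linear-combination (- (C * (nt * ny) * f₂)) b-relation (
    solve (A ∷ B ∷ C ∷ a₁ ∷ a₂ ∷ b₁ ∷ b₂ ∷ nt ∷ ny ∷ nz ∷ f₀ ∷ f₁ ∷ f₂ ∷ g₀ ∷ g₁ ∷ g₂ ∷ []))))))

open import Data.List.Relation.Unary.All using (All; []; _∷_)
open import Data.List.Relation.Unary.AllPairs using (AllPairs; []; _∷_; tail)
open import Data.Vec using (Vec; []; _∷_; lookup; toList; transpose; zipWith)

-- With u² = x / z and q² = p, the weights are those of σ(q²uu′), σ(q²/uu′) and σ(q⁴), where σ(u) = u − 1/u,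
-- cleared of denominators; the product of the two weights C and C · n x · n y of the flips is σ(q⁴)² up to
-- this factor.  A and B are the weights σ(q⁴u′/u) and σ(u/u′) that intertwine two lines.
module Weights (p : ℤ) where

  opaque
    C : ℤ
    C = p * p * (p * p) - 1ℤ

    n : Param → ℤ
    n (x , z) = x * z

    a b A B : Param → Param → ℤ
    a (x , z) (x′ , z′) = p * (p * p * (x * x′) - z * z′)
    b (x , z) (x′ , z′) = p * (p * p * (z * z′) - x * x′)
    A (x , z) (x′ , z′) = p * p * (p * p) * (x′ * z) - x * z′
    B (x , z) (x′ , z′) = p * p * (x * z′ - x′ * z)

    a-exchange : ∀ t y z → A y z * a t y ≡ C * n y * a t z + B y z * b t y
    a-exchange (t₀ , t₁) (y₀ , y₁) (z₀ , z₁) = lem p t₀ t₁ y₀ y₁ z₀ z₁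
      where
      lem : ∀ p t₀ t₁ y₀ y₁ z₀ z₁ →
        (p * p * (p * p) * (z₀ * y₁) - y₀ * z₁) * (p * (p * p * (t₀ * y₀) - t₁ * y₁)) ≡
        (p * p * (p * p) - 1ℤ) * (y₀ * y₁) * (p * (p * p * (t₀ * z₀) - t₁ * z₁)) +
        p * p * (y₀ * z₁ - z₀ * y₁) * (p * (p * p * (t₁ * y₁) - t₀ * y₀))
      lem = solve-∀

    -- The image of `a-exchange` under inversion of all parameters, with `y` and `z` interchanged.
    b-exchange : ∀ t y z → A y z * b t z ≡ C * n z * b t y + B y z * a t z
    b-exchange (t₀ , t₁) (y₀ , y₁) (z₀ , z₁) = lem p t₀ t₁ y₀ y₁ z₀ z₁
      where
      lem : ∀ p t₀ t₁ y₀ y₁ z₀ z₁ →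
        (p * p * (p * p) * (z₀ * y₁) - y₀ * z₁) * (p * (p * p * (t₁ * z₁) - t₀ * z₀)) ≡
        (p * p * (p * p) - 1ℤ) * (z₀ * z₁) * (p * (p * p * (t₁ * y₁) - t₀ * y₀)) +
        p * p * (y₀ * z₁ - z₀ * y₁) * (p * (p * p * (t₀ * z₀) - t₁ * z₁))
      lem = solve-∀

    ab-exchange : ∀ t y z → a t y * b t z ≡ b t y * a t z + B y z * (C * n t)
    ab-exchange (t₀ , t₁) (y₀ , y₁) (z₀ , z₁) = lem p t₀ t₁ y₀ y₁ z₀ z₁
      where
      lem : ∀ p t₀ t₁ y₀ y₁ z₀ z₁ →
        p * (p * p * (t₀ * y₀) - t₁ * y₁) * (p * (p * p * (t₁ * z₁) - t₀ * z₀)) ≡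
        p * (p * p * (t₁ * y₁) - t₀ * y₀) * (p * (p * p * (t₀ * z₀) - t₁ * z₁)) +
        p * p * (y₀ * z₁ - z₀ * y₁) * ((p * p * (p * p) - 1ℤ) * (t₀ * t₁))
      lem = solve-∀

    a-sym : ∀ x y → a x y ≡ a y x
    a-sym (x , z) (x′ , z′) rewrite *-comm x x′ | *-comm z z′ = refl

    b-sym : ∀ x y → b x y ≡ b y x
    b-sym (x , z) (x′ , z′) rewrite *-comm x x′ | *-comm z z′ = refl

    a-inv : ∀ x y → a (swap x) (swap y) ≡ b x y
    a-inv x y = refl

    b-inv : ∀ x y → b (swap x) (swap y) ≡ a x y
    b-inv x y = refl

    n-inv : ∀ x → n (swap x) ≡ n x
    n-inv (x , z) = *-comm z x

    -- Inversion interchanges the two arguments of the intertwiner. Exchange relations are therefore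
    -- carried to exchange relations only if the order of the lines is reversed too.
    A-inv : ∀ x y → A (swap y) (swap x) ≡ A x y
    A-inv (x , z) (x′ , z′) rewrite *-comm z x′ | *-comm z′ x = refl

    B-inv : ∀ x y → B (swap y) (swap x) ≡ B x y
    B-inv (x , z) (x′ , z′) rewrite *-comm z x′ | *-comm z′ x = refl

-- Partition functions of line configurations and their exchange relations

module Lines (p : ℤ) where
  open Weights p

  vertex : Param → Param → Bool → Bool → (Bool → Bool → ℤ) → ℤ
  vertex x y false false K = a x y * K false false + C * K true true
  vertex x y false true  K = b x y * K false true
  vertex x y true  false K = b x y * K true false
  vertex x y true  true  K = a x y * K true true + C * (n x * n y) * K false false

  -- The line x, in state h, crosses the lines ys, whose states are σ; K weights the states after the
  -- crossings.  The line x must leave in state 1.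
  row : Param → Bool → List Param → List Bool → (List Bool → ℤ) → ℤ
  row x h     []       []      K = if h then K [] else 0ℤ
  row x h     []       (_ ∷ _) K = 0ℤ
  row x h     (y ∷ ys) []      K = 0ℤ
  row x h     (y ∷ ys) (v ∷ σ) K = vertex x y h v λ h′ v′ → row x h′ ys σ λ τ → K (v′ ∷ τ)

  -- Once the first line has crossed all the others, these form a smaller configuration with new
  -- entry states. On matrices this removes the first row and column.
  ψ : List Param → List Bool → ℤ
  ψ []       []      = 1ℤ
  ψ []       (_ ∷ _) = 0ℤ
  ψ (x ∷ xs) []      = 0ℤ
  ψ (x ∷ xs) (h ∷ σ) = row x h xs σ (ψ xs)

  ψ₁ : List Bool → ℤ
  ψ₁ σ = ψ (map (const unit) σ) σ

  vertex-cong : ∀ x y h v {K L} → (∀ h′ v′ → K h′ v′ ≡ L h′ v′) →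
    vertex x y h v K ≡ vertex x y h v L
  vertex-cong x y false false e rewrite e false false | e true true = refl
  vertex-cong x y false true  e rewrite e false true = refl
  vertex-cong x y true  false e rewrite e true false = refl
  vertex-cong x y true  true  e rewrite e false false | e true true = refl

  row-cong : ∀ x h ys σ {K L} → (∀ τ → length ys ≡ length τ → K τ ≡ L τ) →
    row x h ys σ K ≡ row x h ys σ L
  row-cong x true  []       []      e = e [] refl
  row-cong x false []       []      e = refl
  row-cong x h     []       (_ ∷ _) e = refl
  row-cong x h     (y ∷ ys) []      e = refl
  row-cong x h     (y ∷ ys) (v ∷ σ) e = vertex-cong x y h v λ h′ v′ →
    row-cong x h′ ys σ λ τ q → e (v′ ∷ τ) (cong suc q)

  vertex-sum : ∀ x y h v α β {K L} →
    vertex x y h v (λ h′ v′ → α * K h′ v′ + β * L h′ v′) ≡ α * vertex x y h v K + β * vertex x y h v L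
  vertex-sum x y h v α β {K} {L} = go h v
    where
    two : ∀ α β u w k₁ k₂ l₁ l₂ →
      u * (α * k₁ + β * l₁) + w * (α * k₂ + β * l₂) ≡ α * (u * k₁ + w * k₂) + β * (u * l₁ + w * l₂)
    two = solve-∀
    one : ∀ α β u k l → u * (α * k + β * l) ≡ α * (u * k) + β * (u * l)
    one = solve-∀
    go : ∀ h v → vertex x y h v (λ h′ v′ → α * K h′ v′ + β * L h′ v′) ≡
      α * vertex x y h v K + β * vertex x y h v L
    go false false = two α β (a x y) C (K false false) (K true true) (L false false) (L true true)
    go false true  = one α β (b x y) (K false true) (L false true)
    go true  false = one α β (b x y) (K true false) (L true false)
    go true  true  = two α β (a x y) (C * (n x * n y)) (K true true) (K false false) (L true true) (L false false)

  row-sum : ∀ x h ys σ α β {K L} →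
    row x h ys σ (λ τ → α * K τ + β * L τ) ≡ α * row x h ys σ K + β * row x h ys σ L
  row-sum x h ys σ α β {K} {L} = go x h ys σ
    where
    zero-sum : ∀ α β → 0ℤ ≡ α * 0ℤ + β * 0ℤ
    zero-sum = solve-∀
    go : ∀ x h ys σ {K L} → row x h ys σ (λ τ → α * K τ + β * L τ) ≡
      α * row x h ys σ K + β * row x h ys σ L
    go x true  []       []      = refl
    go x false []       []      = zero-sum α β
    go x h     []       (_ ∷ _) = zero-sum α β
    go x h     (y ∷ ys) []      = zero-sum α β
    go x h     (y ∷ ys) (v ∷ σ) = trans
      (vertex-cong x y h v λ h′ v′ → go x h′ ys σ)
      (vertex-sum x y h v α β)

  row-scale : ∀ x h ys σ α {K} → row x h ys σ (λ τ → α * K τ) ≡ α * row x h ys σ K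
  row-scale x h ys σ α {K} = trans
    (row-cong x h ys σ λ τ _ → sym (lem α (K τ)))
    (trans (row-sum x h ys σ α 0ℤ {K} {K}) (lem α (row x h ys σ K)))
    where
    lem : ∀ α k → α * k + 0ℤ * k ≡ α * k
    lem = solve-∀

  -- Linearity of `row` in its continuation moves an unrelated crossing past the line `x`. In
  -- `rows-step` this brings the two crossings on `z` together.
  row-vertex : ∀ x h ys σ y z v s {K : Bool → Bool → List Bool → ℤ} →
    row x h ys σ (λ τ → vertex y z v s λ v′ s′ → K v′ s′ τ) ≡
    vertex y z v s λ v′ s′ → row x h ys σ (K v′ s′)
  row-vertex x h ys σ y z false false {K} = row-sum x h ys σ (a y z) C {K false false} {K true true}
  row-vertex x h ys σ y z false true  {K} = row-scale x h ys σ (b y z) {K false true}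
  row-vertex x h ys σ y z true  false {K} = row-scale x h ys σ (b y z) {K true false}
  row-vertex x h ys σ y z true  true  {K} =
    row-sum x h ys σ (a y z) (C * (n y * n z)) {K true true} {K false false}

  -- The intertwiner of two neighbouring lines. States are listed by position: the `S₁` term keeps
  -- them in place, so that they change lines, and the `S₂` term lets them travel with their lines.
  S₁ S₂ : Param → Param → Bool → Bool → ℤ
  S₁ x y false false = A x y
  S₁ x y false true  = C * n x
  S₁ x y true  false = C * n y
  S₁ x y true  true  = A x y
  S₂ x y false false = 0ℤ
  S₂ x y false true  = B x y
  S₂ x y true  false = B x y
  S₂ x y true  true  = 0ℤ

  Exchange : Param → Param → (F G : Bool → Bool → ℤ) → Set
  Exchange x y F G = ∀ v w → A x y * G v w ≡ S₁ x y v w * F v w + S₂ x y v w * F w v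

  diag : ∀ A F F′ → A * F + 0ℤ * F′ ≡ A * F
  diag = solve-∀

  exchange-ff : ∀ {x y F G} → Exchange x y F G → A x y * G false false ≡ A x y * F false false
  exchange-ff {x} {y} {F} e = trans (e false false) (diag (A x y) (F false false) (F false false))

  exchange-tt : ∀ {x y F G} → Exchange x y F G → A x y * G true true ≡ A x y * F true true
  exchange-tt {x} {y} {F} e = trans (e true true) (diag (A x y) (F true true) (F true true))

  exchange-cong : ∀ {x y F G F′ G′} → (∀ v w → F v w ≡ F′ v w) → (∀ v w → G v w ≡ G′ v w) →
    Exchange x y F G → Exchange x y F′ G′
  exchange-cong f g e v w rewrite sym (f v w) | sym (f w v) | sym (g v w) = e v w

  exchange-zero : ∀ x y → Exchange x y (λ _ _ → 0ℤ) (λ _ _ → 0ℤ)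
  exchange-zero x y v w = lem (A x y) (S₁ x y v w) (S₂ x y v w)
    where
    lem : ∀ A s t → A * 0ℤ ≡ s * 0ℤ + t * 0ℤ
    lem = solve-∀

  exchange-sum : ∀ {x y F G F′ G′} α β → Exchange x y F G → Exchange x y F′ G′ →
    Exchange x y (λ v w → α * F v w + β * F′ v w) (λ v w → α * G v w + β * G′ v w)
  exchange-sum {x} {y} {F} {G} {F′} {G′} α β e e′ v w =
    linear-combination α (e v w) (linear-combination β (e′ v w)
      (lem α β (A x y) (S₁ x y v w) (S₂ x y v w) (F v w) (F w v) (F′ v w) (F′ w v) (G v w) (G′ v w)))
    where
    lem : ∀ α β A s t f₁ f₂ f₁′ f₂′ g g′ → A * (α * g + β * g′) ≡
      s * (α * f₁ + β * f₁′) + t * (α * f₂ + β * f₂′)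
      + α * (A * g - (s * f₁ + t * f₂)) + β * (A * g′ - (s * f₁′ + t * f₂′))
    lem = solve-∀

  exchange-scale : ∀ {x y F G} α → Exchange x y F G →
    Exchange x y (λ v w → α * F v w) (λ v w → α * G v w)
  exchange-scale {F = F} {G} α e = exchange-cong
    (λ v w → diag α (F v w) (F v w)) (λ v w → diag α (G v w) (G v w))
    (exchange-sum {F = F} {G} {F} {G} α 0ℤ e e)

  vertex-exchange : ∀ {y z} x t h s {F G : Bool → Bool → Bool → Bool → ℤ} →
    (∀ h′ s′ → Exchange y z (F h′ s′) (G h′ s′)) →
    Exchange y z
      (λ v w → vertex x t h s λ h′ s′ → F h′ s′ v w)
      (λ v w → vertex x t h s λ h′ s′ → G h′ s′ v w)
  vertex-exchange x t false false {F} {G} e =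
    exchange-sum {F = F false false} {G false false} {F true true} {G true true}
      (a x t) C (e false false) (e true true)
  vertex-exchange x t false true  {F} {G} e = exchange-scale {F = F false true} {G false true} (b x t) (e false true)
  vertex-exchange x t true  false {F} {G} e = exchange-scale {F = F true false} {G true false} (b x t) (e true false)
  vertex-exchange x t true  true  {F} {G} e =
    exchange-sum {F = F true true} {G true true} {F false false} {G false false}
      (a x t) (C * (n x * n t)) (e true true) (e false false)

  row-exchange : ∀ {y z} x h ys σ {F G : Bool → Bool → List Bool → ℤ} →
    (∀ τ → Exchange y z (λ v w → F v w τ) (λ v w → G v w τ)) →
    Exchange y z (λ v w → row x h ys σ (F v w)) (λ v w → row x h ys σ (G v w))
  row-exchange x true  []       []      e = e []
  row-exchange x false []       []      e = exchange-zero _ _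
  row-exchange x h     []       (_ ∷ _) e = exchange-zero _ _
  row-exchange x h     (y ∷ ys) []      e = exchange-zero _ _
  row-exchange x h     (y ∷ ys) (v ∷ σ) e =
    vertex-exchange x y h v λ h′ v′ → row-exchange x h′ ys σ λ τ → e (v′ ∷ τ)

  -- The intertwiner of `y` and `z` is moved through the line `t`. The relation is assumed only for
  -- the continuations after both crossings, so the step can be iterated.
  yang-baxter : ∀ t y z s {F G : Bool → Bool → Bool → ℤ} → (∀ s′ → Exchange y z (F s′) (G s′)) →
    Exchange y z
      (λ v w → vertex t y s v λ s₁ v′ → vertex t z s₁ w λ s₂ w′ → F s₂ v′ w′)
      (λ v w → vertex t z s v λ s₁ v′ → vertex t y s₁ w λ s₂ w′ → G s₂ v′ w′)
  yang-baxter t y z s {F} {G} e = go s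
    where
    swap-product : ∀ A u v f g → A * g ≡ A * f → A * (v * (u * g)) ≡ A * (u * (v * f)) + 0ℤ * (u * (v * f))
    swap-product A u v f g h = linear-combination (u * v) h (lem A u v f g)
      where
      lem : ∀ A u v f g → A * (v * (u * g)) ≡
        A * (u * (v * f)) + 0ℤ * (u * (v * f)) + u * v * (A * g - A * f)
      lem = solve-∀
    ff : ∀ s → A y z * G s false false ≡ A y z * F s false false
    ff s = exchange-ff {F = F s} {G s} (e s)
    tt : ∀ s → A y z * G s true true ≡ A y z * F s true true
    tt s = exchange-tt {F = F s} {G s} (e s)
    open LocalExchange (A y z) (B y z) C (a t y) (a t z) (b t y) (b t z) (n t) (n y) (n z)
      (a-exchange t y z) (b-exchange t y z) (ab-exchange t y z)
    go : ∀ s → Exchange y z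
      (λ v w → vertex t y s v λ s₁ v′ → vertex t z s₁ w λ s₂ w′ → F s₂ v′ w′)
      (λ v w → vertex t z s v λ s₁ v′ → vertex t y s₁ w λ s₂ w′ → G s₂ v′ w′)
    go false false false = trans
      (local-fff (F false false false) (F true false true) (F true true false)
        (G false false false) (G true false true) (G true true false)
        (ff false) (e true false true) (e true true false))
      (sym (diag (A y z) _ (F false false false)))
    go false true false =
      local-ftf (F true true true) (F false true false) (F false false true)
        (G true true true) (G false true false)
        (e false true false) (tt true)
    go false false true =
      local-fft (F true true true) (F false true false) (F false false true)
        (G true true true) (G false true false) (G false false true)
        (e false false true) (tt true) (e false true false)
    go false true true = swap-product (A y z) (b t y) (b t z) (F false true true) (G false true true) (tt false)
    go true false false = swap-product (A y z) (b t y) (b t z) (F true false false) (G true false false) (ff true)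
    go true true false =
      local-ttf (F false false false) (F true true false) (F true false true)
        (G false false false) (G true true false) (G true false true)
        (e true true false) (ff false) (e true false true)
    go true false true =
      local-tft (F false false false) (F true true false) (F true false true)
        (G false false false) (G true false true)
        (e true false true) (ff false)
    go true true true = trans
      (local-ttt (F true true true) (F false true false) (F false false true)
        (G true true true) (G false true false) (G false false true)
        (tt true) (e false true false) (e false false true))
      (sym (diag (A y z) _ (F false false false)))

  vertex-sym : ∀ x y h v {K} → vertex x y h v K ≡ vertex y x v h λ v′ h′ → K h′ v′
  vertex-sym x y false false rewrite a-sym x y = refl
  vertex-sym x y false true  rewrite b-sym x y = refl
  vertex-sym x y true  false rewrite b-sym x y = refl
  vertex-sym x y true  true  rewrite a-sym x y | *-comm (n x) (n y) = refl

  rows : Param → Param → List Param → List Bool → (List Bool → ℤ) → Bool → Bool → ℤ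
  rows x y zs σ K h v = row x h zs σ λ τ → row y v zs τ K

  rows-step : ∀ x y z zs s σ K h v → rows x y (z ∷ zs) (s ∷ σ) K h v ≡
    vertex z x s h λ s′ h′ → vertex z y s′ v λ s″ v′ → rows x y zs σ (λ τ → K (s″ ∷ τ)) h′ v′
  rows-step x y z zs s σ K h v = trans
    (vertex-cong x z h s λ h′ s′ → trans
      (row-vertex x h′ zs σ y z v s′)
      (vertex-sym y z v s′))
    (vertex-sym x z h s)

  -- The train argument: the intertwiner passes one line `z` at a time. At the far end both lines
  -- must leave in state 1, where it acts as the scalar `A x y`.
  rows-exchange : ∀ x y zs σ K → Exchange x y (rows x y zs σ K) (rows y x zs σ K)
  rows-exchange x y [] [] K false false = exchange-zero x y false false
  rows-exchange x y [] [] K false true  = exchange-zero x y false true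
  rows-exchange x y [] [] K true  false = exchange-zero x y true false
  rows-exchange x y [] [] K true  true  = sym (diag (A x y) (K []) (K []))
  rows-exchange x y [] (_ ∷ _) K = exchange-zero x y
  rows-exchange x y (z ∷ zs) [] K = exchange-zero x y
  rows-exchange x y (z ∷ zs) (s ∷ σ) K = exchange-cong
    (λ h v → sym (rows-step x y z zs s σ K h v))
    (λ h v → sym (rows-step y x z zs s σ K h v))
    (yang-baxter z x y s λ s′ → rows-exchange x y zs σ λ τ → K (s′ ∷ τ))

  -- The crossing of `x` with `y` commutes with the intertwiner: it scales both mixed states by the
  -- same `b`, and it mixes only the two equal states, on which the intertwiner is the scalar
  -- `A x y`.
  crossing-exchange : ∀ {x y F G} → Exchange x y F G →
    Exchange x y (λ h v → vertex x y h v F) (λ h v → vertex y x h v G)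
  crossing-exchange {x} {y} {F} {G} e = go
    where
    both : ∀ A u w f₁ f₂ g₁ g₂ f → A * g₁ ≡ A * f₁ → A * g₂ ≡ A * f₂ →
      A * (u * g₁ + w * g₂) ≡ A * (u * f₁ + w * f₂) + 0ℤ * f
    both A u w f₁ f₂ g₁ g₂ f h₁ h₂ =
      linear-combination u h₁ (linear-combination w h₂ (lem A u w f₁ f₂ g₁ g₂ f))
      where
      lem : ∀ A u w f₁ f₂ g₁ g₂ f → A * (u * g₁ + w * g₂) ≡
        A * (u * f₁ + w * f₂) + 0ℤ * f + u * (A * g₁ - A * f₁) + w * (A * g₂ - A * f₂)
      lem = solve-∀
    one : ∀ A u s t f₁ f₂ g → A * g ≡ s * f₁ + t * f₂ → A * (u * g) ≡ s * (u * f₁) + t * (u * f₂)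
    one A u s t f₁ f₂ g h = linear-combination u h (lem A u s t f₁ f₂ g)
      where
      lem : ∀ A u s t f₁ f₂ g → A * (u * g) ≡
        s * (u * f₁) + t * (u * f₂) + u * (A * g - (s * f₁ + t * f₂))
      lem = solve-∀
    ff = exchange-ff {F = F} {G} e
    tt = exchange-tt {F = F} {G} e
    go : Exchange x y (λ h v → vertex x y h v F) (λ h v → vertex y x h v G)
    go false false rewrite a-sym y x =
      both (A x y) (a x y) C (F false false) (F true true) (G false false) (G true true) (F false false) ff tt
    go false true  rewrite b-sym y x =
      one (A x y) (b x y) (C * n x) (B x y) (F false true) (F true false) (G false true) (e false true)
    go true  false rewrite b-sym y x =
      one (A x y) (b x y) (C * n y) (B x y) (F true false) (F false true) (G true false) (e true false)
    go true  true  rewrite a-sym y x | *-comm (n y) (n x) =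
      both (A x y) (a x y) (C * (n x * n y)) (F true true) (F false false) (G true true) (G false false)
        (F true true) tt ff

  -- A line further to the left crosses `y` and `z` in succession: Yang-Baxter applies at these two
  -- crossings, linearity at all others.
  row-exchange-at : ∀ {y z} x h ls σl zs σ {K L} → length ls ≡ length σl →
    (∀ τl τ → length ls ≡ length τl →
      Exchange y z (λ v w → K (τl ++ v ∷ w ∷ τ)) (λ v w → L (τl ++ v ∷ w ∷ τ))) →
    Exchange y z
      (λ v w → row x h (ls ++ y ∷ z ∷ zs) (σl ++ v ∷ w ∷ σ) K)
      (λ v w → row x h (ls ++ z ∷ y ∷ zs) (σl ++ v ∷ w ∷ σ) L)
  row-exchange-at x h []       []       zs σ _ e =
    yang-baxter x _ _ h λ h′ → row-exchange x h′ zs σ λ τ → e [] τ refl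
  row-exchange-at x h (l ∷ ls) (s ∷ σl) zs σ q e =
    vertex-exchange x l h s λ h′ s′ → row-exchange-at x h′ ls σl zs σ (ℕ.suc-injective q)
      λ τl τ q′ → e (s′ ∷ τl) τ (cong suc q′)

  ψ-exchange : ∀ {x y} ls σl zs σ → length ls ≡ length σl →
    Exchange x y
      (λ h v → ψ (ls ++ x ∷ y ∷ zs) (σl ++ h ∷ v ∷ σ))
      (λ h v → ψ (ls ++ y ∷ x ∷ zs) (σl ++ h ∷ v ∷ σ))
  ψ-exchange []       []       zs σ _ = crossing-exchange (rows-exchange _ _ zs σ (ψ zs))
  ψ-exchange (l ∷ ls) (s ∷ σl) zs σ q = row-exchange-at l s ls σl zs σ (ℕ.suc-injective q)
    λ τl τ q′ → ψ-exchange ls τl zs τ q′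

-- Permutations of lists and sums over a distinguished element

ʳ++⁺ : ∀ (ls : List X) {xs ys} → xs ↭ ys → ls ʳ++ xs ↭ ls ʳ++ ys
ʳ++⁺ []       r = r
ʳ++⁺ (l ∷ ls) r = ʳ++⁺ ls (prep l r)

ʳ++-flip : ∀ (ls : List X) y rs → ls ʳ++ y ∷ rs ↭ rs ʳ++ y ∷ ls
ʳ++-flip ls y rs = ↭-trans
  (↭-reflexive (sym (trans (ʳ++-ʳ++ rs) (cong (λ t → ls ʳ++ y ∷ t) (++-identityʳ rs)))))
  (↭-reverse (rs ʳ++ y ∷ ls))

AllPairs-resp-↭ : {R : X → X → Set} → Symmetric R →
  ∀ {xs ys} → xs ↭ ys → AllPairs R xs → AllPairs R ys
AllPairs-resp-↭ s refl d = d
AllPairs-resp-↭ s (prep x r) (h ∷ d) = All-resp-↭ r h ∷ AllPairs-resp-↭ s r d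
AllPairs-resp-↭ s (↭swap x y r) ((h ∷ hx) ∷ hy ∷ d) =
  (s h ∷ All-resp-↭ r hy) ∷ All-resp-↭ r hx ∷ AllPairs-resp-↭ s r d
AllPairs-resp-↭ s (↭then r r′) d = AllPairs-resp-↭ s r′ (AllPairs-resp-↭ s r d)

AllPairs-suffix : {R : X → X → Set} → ∀ ls {xs} → AllPairs R (ls ʳ++ xs) → AllPairs R xs
AllPairs-suffix []       d = d
AllPairs-suffix (l ∷ ls) d = tail (AllPairs-suffix ls d)

-- The sum over all ways to single out one element; the part to its left is stored reversed, so that moving
-- past an element, or reversing the whole list, needs no appending.
splits : (List X → X → List X → ℤ) → List X → List X → ℤ
splits f ls []       = 0ℤ
splits f ls (y ∷ rs) = f ls y rs + splits f (y ∷ ls) rs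

-- The summands are compared only at decompositions of the given list, so that genericity or
-- distinctness of its elements can be used.
splits-cong : ∀ {f g : List X → X → List X → ℤ} ls rs →
  (∀ ls′ y rs′ → ls′ ʳ++ y ∷ rs′ ≡ ls ʳ++ rs → f ls′ y rs′ ≡ g ls′ y rs′) →
  splits f ls rs ≡ splits g ls rs
splits-cong ls []       e = refl
splits-cong ls (y ∷ rs) e = cong₂ _+_ (e ls y rs refl) (splits-cong (y ∷ ls) rs e)

splits-map : ∀ (g : X → Y) (f : List Y → Y → List Y → ℤ) ls rs →
  splits f (map g ls) (map g rs) ≡ splits (λ ls y rs → f (map g ls) (g y) (map g rs)) ls rs
splits-map g f ls []       = refl
splits-map g f ls (y ∷ rs) = cong (λ t → f (map g ls) (g y) (map g rs) + t) (splits-map g f (y ∷ ls) rs)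

-- Cut the list anywhere: the sum over the elements to the right of the cut, plus the sum over those
-- to its left read backwards, does not depend on the cut. The two extreme cuts give the two sides.
splits-reverse : ∀ (f : List X → X → List X → ℤ) xs →
  splits f [] xs ≡ splits (λ ls y rs → f rs y ls) [] (reverse xs)
splits-reverse {X} f xs = trans (sym (+-identityʳ _)) (trans (shift [] xs) (+-identityˡ _))
  where
  f′ : List X → X → List X → ℤ
  f′ ls y rs = f rs y ls
  move : ∀ u v w → u + v + w ≡ v + (u + w)
  move = solve-∀
  shift : ∀ ls rs → splits f ls rs + splits f′ rs ls ≡ splits f (rs ʳ++ ls) [] + splits f′ [] (rs ʳ++ ls)
  shift ls []       = refl
  shift ls (y ∷ rs) = trans
    (move (f ls y rs) (splits f (y ∷ ls) rs) (splits f′ (y ∷ rs) ls))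
    (shift (y ∷ ls) rs)

zeros : List X → List Bool
zeros = map (const false)

length-zeros : (xs : List X) → length xs ≡ length (zeros xs)
length-zeros xs = sym (length-map _ xs)

mark : List X → List X → List Bool
mark ls rs = zeros ls ʳ++ true ∷ zeros rs

length-mark : (ls rs : List X) → length (mark ls rs) ≡ suc (length ls ℕ.+ length rs)
length-mark ls rs = trans (length-ʳ++ (zeros ls))
  (trans (cong₂ (λ u v → u ℕ.+ suc v) (length-map _ ls) (length-map _ rs)) (ℕ.+-suc (length ls) (length rs)))

mark-map : ∀ (f : X → Y) ls rs → mark (map f ls) (map f rs) ≡ mark ls rs
mark-map f ls rs = cong₂ (λ σ τ → σ ʳ++ true ∷ τ) (sym (map-∘ ls)) (sym (map-∘ rs))

map-const : ∀ (y : Y) (xs : List X) (zs : List W) → length xs ≡ length zs → map (const y) xs ≡ map (const y) zs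
map-const y []       []       _ = refl
map-const y (x ∷ xs) (z ∷ zs) q = cong (y ∷_) (map-const y xs zs (ℕ.suc-injective q))

-- Invariance under inversion of the parameters

module Inversion (p : ℤ) where
  open Weights p
  open Lines p

  inv : Param → Param
  inv = swap

  Z : List Param → ℤ
  Z xs = ψ xs (zeros xs)

  E : List Param → Param → List Param → ℤ
  E ls y rs = ψ (ls ʳ++ y ∷ rs) (mark ls rs)

  ψ-exchangeʳ : ∀ {x y} ls σl zs σ → length ls ≡ length σl →
    Exchange x y
      (λ h v → ψ (ls ʳ++ x ∷ y ∷ zs) (σl ʳ++ h ∷ v ∷ σ))
      (λ h v → ψ (ls ʳ++ y ∷ x ∷ zs) (σl ʳ++ h ∷ v ∷ σ))
  ψ-exchangeʳ {x} {y} ls σl zs σ q = exchange-cong {x} {y}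
    (λ h v → cong₂ ψ (sym (ʳ++-defn ls)) (sym (ʳ++-defn σl)))
    (λ h v → cong₂ ψ (sym (ʳ++-defn ls)) (sym (ʳ++-defn σl)))
    (ψ-exchange (reverse ls) (reverse σl) zs σ
      (trans (length-reverse ls) (trans q (sym (length-reverse σl)))))

  -- The two mixed entries of the intertwiner. Under inversion with reversal the marked line moves
  -- from the left to the right position of the pair, which is why `E-inversion` needs both.
  E-right : ∀ x y ls rs → A x y * E ls y (x ∷ rs) ≡ C * n y * E ls x (y ∷ rs) + B x y * E (x ∷ ls) y rs
  E-right x y ls rs = ψ-exchangeʳ {x} {y} ls (zeros ls) rs (zeros rs) (length-zeros ls) true false

  E-left : ∀ x y ls rs → A x y * E (y ∷ ls) x rs ≡ C * n x * E (x ∷ ls) y rs + B x y * E ls x (y ∷ rs)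
  E-left x y ls rs = ψ-exchangeʳ {x} {y} ls (zeros ls) rs (zeros rs) (length-zeros ls) false true

  -- `A` is cancelled to permute the lines of `Z`, and `B` to move the mark of `E`. Asking for both
  -- orders makes the relation symmetric, hence stable under permutation and inversion.
  Separated : Param → Param → Set
  Separated x y = (A x y ≢ 0ℤ × B x y ≢ 0ℤ) × (A y x ≢ 0ℤ × B y x ≢ 0ℤ)

  Generic : List Param → Set
  Generic = AllPairs Separated

  generic-resp-↭ : ∀ {xs ys} → xs ↭ ys → Generic xs → Generic ys
  generic-resp-↭ = AllPairs-resp-↭ swap

  generic-inv : ∀ {xs} → Generic xs → Generic (map inv xs)
  generic-inv g = AllPairs.map⁺ (AllPairs.map (λ {x} {y} → separated-inv x y) g)
    where
    separated-inv : ∀ x y → Separated x y → Separated (inv x) (inv y)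
    separated-inv x y ((d₁ , d₂) , d₃ , d₄)
      rewrite sym (A-inv x y) | sym (B-inv x y) | sym (A-inv y x) | sym (B-inv y x) = (d₃ , d₄) , d₁ , d₂

  cancel : ∀ u {v w} → u ≢ 0ℤ → u * v ≡ u * w → v ≡ w
  cancel u {v} {w} u≢0 = *-cancelˡ-≡ u v w {{≢-nonZero u≢0}}

  Z-swap : ∀ ls x y zs → A x y ≢ 0ℤ → Z (ls ʳ++ x ∷ y ∷ zs) ≡ Z (ls ʳ++ y ∷ x ∷ zs)
  Z-swap ls x y zs A≢0 rewrite map-ʳ++ (const false) ls {x ∷ y ∷ zs} | map-ʳ++ (const false) ls {y ∷ x ∷ zs} =
    sym (cancel (A x y) A≢0 (exchange-ff {x} {y}
      {λ h v → ψ (ls ʳ++ x ∷ y ∷ zs) (zeros ls ʳ++ h ∷ v ∷ zeros zs)}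
      (ψ-exchangeʳ {x} {y} ls (zeros ls) zs (zeros zs) (length-zeros ls))))

  Z-↭ʳ : ∀ ls {xs ys} → xs ↭ ys → Generic (ls ʳ++ xs) → Z (ls ʳ++ xs) ≡ Z (ls ʳ++ ys)
  Z-↭ʳ ls refl         g = refl
  Z-↭ʳ ls (prep x r)   g = Z-↭ʳ (x ∷ ls) r g
  Z-↭ʳ ls (↭swap {xs} x y r) g with AllPairs-suffix ls g
  ... | (((A≢0 , _) , _) ∷ _) ∷ _ = trans (Z-swap ls x y xs A≢0)
    (Z-↭ʳ (x ∷ y ∷ ls) r (generic-resp-↭ (ʳ++⁺ ls (↭swap x y ↭-refl)) g))
  Z-↭ʳ ls (↭then r r′) g = trans (Z-↭ʳ ls r g) (Z-↭ʳ ls r′ (generic-resp-↭ (ʳ++⁺ ls r) g))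

  Z-↭ : ∀ {xs ys} → xs ↭ ys → Generic xs → Z xs ≡ Z ys
  Z-↭ = Z-↭ʳ []

  Πa Πb : Param → List Param → ℤ
  Πa x []       = 1ℤ
  Πa x (y ∷ ys) = a x y * Πa x ys
  Πb x []       = 1ℤ
  Πb x (y ∷ ys) = b x y * Πb x ys

  Πa-inv : ∀ x ys → Πa (inv x) (map inv ys) ≡ Πb x ys
  Πa-inv x []       = refl
  Πa-inv x (y ∷ ys) = cong₂ _*_ (a-inv x y) (Πa-inv x ys)

  Πb-inv : ∀ x ys → Πb (inv x) (map inv ys) ≡ Πa x ys
  Πb-inv x []       = refl
  Πb-inv x (y ∷ ys) = cong₂ _*_ (b-inv x y) (Πb-inv x ys)

  *-swap : ∀ u v w → u * (v * w) ≡ v * (u * w)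
  *-swap = solve-∀

  Πa-↭ : ∀ x {ys zs} → ys ↭ zs → Πa x ys ≡ Πa x zs
  Πa-↭ x refl = refl
  Πa-↭ x (prep y r) = cong (a x y *_) (Πa-↭ x r)
  Πa-↭ x (↭swap {ys} y z r) = trans
    (*-swap (a x y) (a x z) (Πa x ys))
    (cong (λ q → a x z * (a x y * q)) (Πa-↭ x r))
  Πa-↭ x (↭then r r′) = trans (Πa-↭ x r) (Πa-↭ x r′)

  -- A line in state 1 among lines in state 0 is frozen: unequal states cannot flip, so all its
  -- crossings have weight `b`.
  row-true-zeros : ∀ x ys K → row x true ys (zeros ys) K ≡ Πb x ys * K (zeros ys)
  row-true-zeros x []       K = sym (*-identityˡ (K []))
  row-true-zeros x (y ∷ ys) K = trans (cong (b x y *_) (row-true-zeros x ys λ τ → K (false ∷ τ)))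
    (sym (*-assoc (b x y) (Πb x ys) (K (zeros (y ∷ ys)))))

  row-last : ∀ x h ys y σ K → length ys ≡ length σ →
    row x h (ys ++ [ y ]) (σ ++ [ true ]) K ≡ a y x * row x h ys σ (λ τ → K (τ ++ [ true ]))
  row-last x true  [] y [] K _ rewrite a-sym x y = drop (a y x) (K [ true ]) (C * (n x * n y))
    where
    drop : ∀ u k v → u * k + v * 0ℤ ≡ u * k
    drop = solve-∀
  row-last x false [] y [] K _ = trans (*-zeroʳ (b x y)) (sym (*-zeroʳ (a y x)))
  row-last x h (z ∷ ys) y (v ∷ σ) K q = trans
    (vertex-cong x z h v λ h′ v′ → row-last x h′ ys y σ (λ τ → K (v′ ∷ τ)) (ℕ.suc-injective q))
    (vertex-scale h v)
    where
    L : Bool → Bool → ℤ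
    L h′ v′ = row x h′ ys σ λ τ → K (v′ ∷ τ ++ [ true ])
    two : ∀ α u w k₁ k₂ → u * (α * k₁) + w * (α * k₂) ≡ α * (u * k₁ + w * k₂)
    two = solve-∀
    vertex-scale : ∀ h v → vertex x z h v (λ h′ v′ → a y x * L h′ v′) ≡ a y x * vertex x z h v L
    vertex-scale false false = two (a y x) (a x z) C (L false false) (L true true)
    vertex-scale false true  = *-swap (b x z) (a y x) (L false true)
    vertex-scale true  false = *-swap (b x z) (a y x) (L true false)
    vertex-scale true  true  = two (a y x) (a x z) (C * (n x * n z)) (L true true) (L false false)

  ψ-last : ∀ xs y σ → length xs ≡ length σ → ψ (xs ++ [ y ]) (σ ++ [ true ]) ≡ Πa y xs * ψ xs σ
  ψ-last []       y []      _ = refl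
  ψ-last (x ∷ xs) y (s ∷ σ) q = begin
    row x s (xs ++ [ y ]) (σ ++ [ true ]) (ψ (xs ++ [ y ]))
      ≡⟨ row-last x s xs y σ (ψ (xs ++ [ y ])) (ℕ.suc-injective q) ⟩
    a y x * row x s xs σ (λ τ → ψ (xs ++ [ y ]) (τ ++ [ true ]))
      ≡⟨ cong (a y x *_) (row-cong x s xs σ λ τ q′ → ψ-last xs y τ q′) ⟩
    a y x * row x s xs σ (λ τ → Πa y xs * ψ xs τ)
      ≡⟨ cong (a y x *_) (row-scale x s xs σ (Πa y xs) {ψ xs}) ⟩
    a y x * (Πa y xs * row x s xs σ (ψ xs))
      ≡⟨ *-assoc (a y x) (Πa y xs) _ ⟨
    a y x * Πa y xs * row x s xs σ (ψ xs) ∎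
    where open ≡-Reasoning

  E-first : ∀ y rs → E [] y rs ≡ Πb y rs * Z rs
  E-first y rs = row-true-zeros y rs (ψ rs)

  E-last : ∀ ls y → E ls y [] ≡ Πa y (reverse ls) * Z (reverse ls)
  E-last ls y = begin
    ψ (ls ʳ++ [ y ]) (zeros ls ʳ++ [ true ])
      ≡⟨ cong₂ ψ (ʳ++-defn ls) (ʳ++-defn (zeros ls)) ⟩
    ψ (reverse ls ++ [ y ]) (reverse (zeros ls) ++ [ true ])
      ≡⟨ cong (λ σ → ψ (reverse ls ++ [ y ]) (σ ++ [ true ])) (reverse-map (const false) ls) ⟨
    ψ (reverse ls ++ [ y ]) (zeros (reverse ls) ++ [ true ])
      ≡⟨ ψ-last (reverse ls) y (zeros (reverse ls)) (length-zeros (reverse ls)) ⟩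
    Πa y (reverse ls) * Z (reverse ls) ∎
    where open ≡-Reasoning

  InversionFor : ℕ → Set
  InversionFor k = ∀ xs → length xs ≡ k → Generic xs → Z (map inv xs) ≡ Z xs

  -- Induction on the number of lines before the marked one. If there are none, both sides reduce to
  -- `Z` with `k` lines. Otherwise `E-right` and the inverted `E-left` have the same coefficients
  -- and two of their three terms agree by induction, so the third agrees after cancelling `B`. One
  -- of these two terms has `x` and `y` interchanged, so all orders of the lines are treated at
  -- once.
  E-inversion : ∀ k → InversionFor k → ∀ ls y rs →
    length ls ℕ.+ length rs ≡ k → Generic (ls ʳ++ y ∷ rs) →
    E ls y rs ≡ E (map inv rs) (inv y) (map inv ls)
  E-inversion k ih [] y rs q g = begin
    E [] y rs
      ≡⟨ E-first y rs ⟩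
    Πb y rs * Z rs
      ≡⟨ cong₂ _*_ (sym (Πa-inv y rs)) (sym (ih rs q (tail g))) ⟩
    Πa (inv y) rs′ * Z rs′
      ≡⟨ cong₂ _*_ (Πa-↭ (inv y) (↭-sym (↭-reverse rs′)))
           (Z-↭ (↭-sym (↭-reverse rs′)) (generic-inv (tail g))) ⟩
    Πa (inv y) (reverse rs′) * Z (reverse rs′)
      ≡⟨ E-last rs′ (inv y) ⟨
    E rs′ (inv y) [] ∎
    where
    open ≡-Reasoning
    rs′ : List Param
    rs′ = map inv rs
  E-inversion k ih (x ∷ ls) y rs q g with AllPairs-suffix ls g
  ... | (((_ , B≢0) , _) ∷ _) ∷ _ = cancel (B x y) B≢0 (solve-for (C * n y) (A x y) (B x y)
    (E-right x y ls rs)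
    (trans left (cong₂ (λ u v → C * u * E₁ + v * E₂) (n-inv y) (B-inv x y)))
    (E-inversion k ih ls x (y ∷ rs) q′ g)
    (E-inversion k ih ls y (x ∷ rs) q′ (generic-resp-↭ (ʳ++⁺ ls (↭swap x y ↭-refl)) g)))
    where
    E₁ E₂ : ℤ
    E₁ = E (inv y ∷ map inv rs) (inv x) (map inv ls)
    E₂ = E (map inv rs) (inv y) (inv x ∷ map inv ls)
    left : A x y * E (inv x ∷ map inv rs) (inv y) (map inv ls) ≡ C * n (inv y) * E₁ + B (inv y) (inv x) * E₂
    left = subst
      (λ u → u * E (inv x ∷ map inv rs) (inv y) (map inv ls) ≡
        C * n (inv y) * E₁ + B (inv y) (inv x) * E₂)
      (A-inv x y) (E-left (inv y) (inv x) (map inv rs) (map inv ls))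
    q′ : length ls ℕ.+ suc (length rs) ≡ k
    q′ = trans (ℕ.+-suc (length ls) (length rs)) q
    solve-for : ∀ c A B {e e₁ e₂ e′ e₁′ e₂′} →
      A * e ≡ c * e₁ + B * e₂ → A * e′ ≡ c * e₁′ + B * e₂′ →
      e₁ ≡ e₁′ → e ≡ e′ → B * e₂ ≡ B * e₂′
    solve-for c A B {e} {e₁} {e₂} {e₂′ = e₂′} h h′ refl refl =
      +-cancelˡ (c * e₁) (B * e₂) (B * e₂′) (trans (sym h) h′)

  -- The contribution to `Z` in which the line `x` makes its only flip at `y`, leaving `y` as the
  -- one remaining line in state 1.
  term : Param → List Param → Param → List Param → ℤ
  term x ls y rs = Πa x ls * (C * (Πb x rs * E ls y rs))

  row-false-zeros : ∀ x ls rs →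
    Πa x ls * row x false rs (zeros rs) (λ τ → ψ (ls ʳ++ rs) (zeros ls ʳ++ τ)) ≡ splits (term x) ls rs
  row-false-zeros x ls []       = *-zeroʳ (Πa x ls)
  row-false-zeros x ls (y ∷ rs) = begin
    Πa x ls * (a x y * r₀ + C * r₁)
      ≡⟨ expand (Πa x ls) (a x y) C r₀ r₁ ⟩
    Πa x ls * (C * r₁) + Πa x (y ∷ ls) * r₀
      ≡⟨ cong₂ (λ u v → Πa x ls * (C * u) + v)
          (row-true-zeros x rs λ τ → ψ (ls ʳ++ y ∷ rs) (zeros ls ʳ++ true ∷ τ))
          (row-false-zeros x (y ∷ ls) rs) ⟩
    term x ls y rs + splits (term x) (y ∷ ls) rs ∎
    where
    open ≡-Reasoning
    r₀ r₁ : ℤ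
    r₀ = row x false rs (zeros rs) (λ τ → ψ (ls ʳ++ y ∷ rs) (zeros ls ʳ++ false ∷ τ))
    r₁ = row x true rs (zeros rs) (λ τ → ψ (ls ʳ++ y ∷ rs) (zeros ls ʳ++ true ∷ τ))
    expand : ∀ π a c r₀ r₁ → π * (a * r₀ + c * r₁) ≡ π * (c * r₁) + a * π * r₀
    expand = solve-∀

  Z-splits : ∀ x xs → Z (x ∷ xs) ≡ splits (term x) [] xs
  Z-splits x xs = trans (sym (*-identityˡ (Z (x ∷ xs)))) (row-false-zeros x [] xs)

  -- Inversion exchanges the `a` and `b` factors of a term and so turns it into the mirror term. The
  -- sum becomes `Z` with the lines after the first reversed, and symmetry of `Z` restores their
  -- order.
  inversion : ∀ k → InversionFor k
  inversion zero          []       _ _ = refl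
  inversion (suc zero)    (x ∷ []) _ _ = refl
  inversion (suc (suc k)) (x ∷ xs) q g = begin
    Z (inv x ∷ map inv xs)
      ≡⟨ Z-splits (inv x) (map inv xs) ⟩
    splits (term (inv x)) [] (map inv xs)
      ≡⟨ splits-map inv (term (inv x)) [] xs ⟩
    splits (λ ls y rs → term (inv x) (map inv ls) (inv y) (map inv rs)) [] xs
      ≡⟨ splits-cong [] xs (λ ls y rs e → flip-term ls y rs e) ⟩
    splits (λ ls y rs → term x rs y ls) [] xs
      ≡⟨ splits-reverse (λ ls y rs → term x rs y ls) xs ⟩
    splits (term x) [] (reverse xs)
      ≡⟨ Z-splits x (reverse xs) ⟨
    Z (x ∷ reverse xs)
      ≡⟨ Z-↭ (prep x (↭-sym (↭-reverse xs))) g ⟨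
    Z (x ∷ xs) ∎
    where
    open ≡-Reasoning
    flip-term : ∀ ls y rs → ls ʳ++ y ∷ rs ≡ xs →
      term (inv x) (map inv ls) (inv y) (map inv rs) ≡ term x rs y ls
    flip-term ls y rs refl = trans
      (cong₂ (λ u v → u * (C * v)) (Πa-inv x ls) (cong₂ _*_ (Πb-inv x rs)
        (sym (E-inversion k (inversion k) rs y ls size (generic-resp-↭ (ʳ++-flip ls y rs) (tail g))))))
      (rearrange (Πb x ls) C (Πa x rs) (E rs y ls))
      where
      rearrange : ∀ u c v e → u * (c * (v * e)) ≡ v * (c * (u * e))
      rearrange = solve-∀
      size : length rs ℕ.+ length ls ≡ k
      size = ℕ.suc-injective (begin
        suc (length rs ℕ.+ length ls)  ≡⟨ cong suc (ℕ.+-comm (length rs) (length ls)) ⟩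
        suc (length ls ℕ.+ length rs)  ≡⟨ ℕ.+-suc (length ls) (length rs) ⟨
        length ls ℕ.+ suc (length rs)  ≡⟨ length-ʳ++ ls ⟨
        length (ls ʳ++ y ∷ rs)         ≡⟨ ℕ.suc-injective q ⟩
        suc k                          ∎)

  E-inv : ∀ ls y rs → Generic (ls ʳ++ y ∷ rs) → E ls y rs ≡ E (map inv rs) (inv y) (map inv ls)
  E-inv ls y rs = E-inversion _ (inversion _) ls y rs refl

-- Descent to equal parameters

-- The single instance `t = ∣ e ∣` suffices: a nonzero multiple of `∣ e ∣ + 2` cannot be as small as
-- `e`. The lemma serves both for the modulus and for the integer `p`.
multiple-of-all⇒0 : ∀ e → (∀ t → ∃ λ q → e ≡ + suc (suc t) * q) → e ≡ 0ℤ
multiple-of-all⇒0 e h with h ∣ e ∣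
... | q , eq = ∣i∣≡0⇒i≡0 (small ∣ e ∣ ∣ q ∣ (trans (cong ∣_∣ eq) (abs-* (+ suc (suc ∣ e ∣)) q)))
  where
  small : ∀ u v → u ≡ suc (suc u) ℕ.* v → u ≡ 0
  small u zero    eq = trans eq (ℕ.*-zeroʳ (suc (suc u)))
  small u (suc v) eq = ⊥-elim (ℕ.<-irrefl refl (ℕ.<-≤-trans (ℕ.n<1+n u)
    (ℕ.≤-trans (ℕ.n≤1+n (suc u))
      (ℕ.≤-trans (ℕ.m≤m*n (suc (suc u)) (suc v)) (ℕ.≤-reflexive (sym eq))))))

module Congruence (m : ℤ) where

  infix 4 _≈_
  record _≈_ (x y : ℤ) : Set where
    constructor _by_
    field
      quotient : ℤ
      equation : x ≡ y + m * quotient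

  ≈-refl : ∀ {x} → x ≈ x
  ≈-refl {x} = 0ℤ by lem x m
    where
    lem : ∀ x m → x ≡ x + m * 0ℤ
    lem = solve-∀

  +-≈ : ∀ {x x′ y y′} → x ≈ x′ → y ≈ y′ → x + y ≈ x′ + y′
  +-≈ {x′ = x′} {y′ = y′} (q by refl) (r by refl) = (q + r) by lem x′ y′ m q r
    where
    lem : ∀ x y m q r → x + m * q + (y + m * r) ≡ x + y + m * (q + r)
    lem = solve-∀

  *-≈ : ∀ {x x′ y y′} → x ≈ x′ → y ≈ y′ → x * y ≈ x′ * y′
  *-≈ {x′ = x′} {y′ = y′} (q by refl) (r by refl) = (q * y′ + x′ * r + m * (q * r)) by lem x′ y′ m q r
    where
    lem : ∀ x y m q r → (x + m * q) * (y + m * r) ≡ x * y + m * (q * y + x * r + m * (q * r))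
    lem = solve-∀

  neg-≈ : ∀ {x x′} → x ≈ x′ → - x ≈ - x′
  neg-≈ {x′ = x′} (q by refl) = (- q) by lem x′ m q
    where
    lem : ∀ x m q → - (x + m * q) ≡ - x + m * (- q)
    lem = solve-∀

module Reduction (p m : ℤ) where
  open Weights p
  open Lines p
  open Inversion p using (E)
  open Congruence m

  Near : Param → Set
  Near (x , z) = (x ≈ 1ℤ) × (z ≈ 1ℤ)

  opaque
    unfolding C n a b

    a-≈ : ∀ x y → Near x → Near y → a x y ≈ a unit unit
    a-≈ x y (x₁ , x₂) (y₁ , y₂) =
      *-≈ (≈-refl {p}) (+-≈ (*-≈ (≈-refl {p * p}) (*-≈ x₁ y₁)) (neg-≈ (*-≈ x₂ y₂)))

    b-≈ : ∀ x y → Near x → Near y → b x y ≈ b unit unit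
    b-≈ x y (x₁ , x₂) (y₁ , y₂) =
      *-≈ (≈-refl {p}) (+-≈ (*-≈ (≈-refl {p * p}) (*-≈ x₂ y₂)) (neg-≈ (*-≈ x₁ y₁)))

    n-≈ : ∀ x → Near x → n x ≈ n unit
    n-≈ x (x₁ , x₂) = *-≈ x₁ x₂

  vertex-≈ : ∀ {x y} → Near x → Near y → ∀ h v {K L} → (∀ h′ v′ → K h′ v′ ≈ L h′ v′) →
    vertex x y h v K ≈ vertex unit unit h v L
  vertex-≈ {x} {y} x≈ y≈ false false e =
    +-≈ (*-≈ (a-≈ x y x≈ y≈) (e false false)) (*-≈ (≈-refl {C}) (e true true))
  vertex-≈ {x} {y} x≈ y≈ false true  e = *-≈ (b-≈ x y x≈ y≈) (e false true)
  vertex-≈ {x} {y} x≈ y≈ true  false e = *-≈ (b-≈ x y x≈ y≈) (e true false)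
  vertex-≈ {x} {y} x≈ y≈ true  true  e =
    +-≈ (*-≈ (a-≈ x y x≈ y≈) (e true true))
        (*-≈ (*-≈ (≈-refl {C}) (*-≈ (n-≈ x x≈) (n-≈ y y≈))) (e false false))

  row-≈ : ∀ {x} → Near x → ∀ h {ys} → All Near ys → ∀ σ {K L} → (∀ τ → K τ ≈ L τ) →
    row x h ys σ K ≈ row unit h (map (const unit) ys) σ L
  row-≈ x≈ true  []        []      e = e []
  row-≈ x≈ false []        []      e = ≈-refl
  row-≈ x≈ h     []        (_ ∷ _) e = ≈-refl
  row-≈ x≈ h     (y≈ ∷ _)  []      e = ≈-refl
  row-≈ x≈ h     (y≈ ∷ ys) (v ∷ σ) e =
    vertex-≈ x≈ y≈ h v λ h′ v′ → row-≈ x≈ h′ ys σ λ τ → e (v′ ∷ τ)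

  ψ-≈ : ∀ {xs} → All Near xs → ∀ σ → ψ xs σ ≈ ψ (map (const unit) xs) σ
  ψ-≈ []        []      = ≈-refl
  ψ-≈ []        (_ ∷ _) = ≈-refl
  ψ-≈ (x≈ ∷ xs) []      = ≈-refl
  ψ-≈ (x≈ ∷ xs) (h ∷ σ) = row-≈ x≈ h xs σ λ τ → ψ-≈ xs τ

  E-≈ : ∀ ls y rs (f : X → Param) → (∀ x → Near (f x)) →
    E (map f ls) (f y) (map f rs) ≈ ψ₁ (mark ls rs)
  E-≈ ls y rs f near = subst₂ _≈_
    (cong₂ ψ (map-ʳ++ f ls) (sym (mark-map f ls rs)))
    (cong (λ xs → ψ xs (mark ls rs)) (map-const unit (map f xs) (mark ls rs) size))
    (ψ-≈ (All.map⁺ (All.universal near xs)) (mark ls rs))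
    where
    xs : List _
    xs = ls ʳ++ y ∷ rs
    size : length (map f xs) ≡ length (mark ls rs)
    size = trans (length-map f xs) (trans (length-ʳ++ ls)
      (trans (ℕ.+-suc (length ls) (length rs)) (sym (length-mark ls rs))))

module Homogeneous (p : ℤ) (p≢0 : p ≢ 0ℤ) (p∤1 : ∀ u → p * u ≢ 1ℤ) where

  open Weights p
  open Lines p
  open Inversion p

  module _ (t : ℕ) where

    m : ℤ
    -- The factor `p` makes every `A` below congruent to -1 modulo `p`; the other factor is
    -- unbounded.
    m = p * + suc (suc t)

    open Congruence m
    open Reduction p m

    p*p≢0 : p * p ≢ 0ℤ
    p*p≢0 eq with i*j≡0⇒i≡0∨j≡0 p eq
    ... | inj₁ p≡0 = p≢0 p≡0
    ... | inj₂ p≡0 = p≢0 p≡0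

    -- Here `B` becomes `p * p * m * (i - j)`, nonzero for distinct indices, while a parameter and
    -- its inverse are both congruent to `unit`.
    param : ℕ → Param
    param i = 1ℤ + m * + i , 1ℤ

    param-near : ∀ i → Near (param i)
    param-near i = ((+ i) by refl) , ≈-refl

    inv-near : ∀ i → Near (inv (param i))
    inv-near i = ≈-refl , ((+ i) by refl)

    opaque
      unfolding A B

      A-param : ∀ i j → A (param i) (param j) ≢ 0ℤ
      A-param i j eq = p∤1 (p * p * p * (1ℤ + m * + j) - + suc (suc t) * + i)
        (trans (lem p (+ suc (suc t)) (+ i) (+ j)) (cong (_+ 1ℤ) eq))
        where
        lem : ∀ p t i j → p * (p * p * p * (1ℤ + p * t * j) - t * i) ≡
          (p * p * (p * p) * ((1ℤ + p * t * j) * 1ℤ) - (1ℤ + p * t * i) * 1ℤ) + 1ℤ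
        lem = solve-∀

      B-param : ∀ i j → i ≢ j → B (param i) (param j) ≢ 0ℤ
      B-param i j i≢j eq with i*j≡0⇒i≡0∨j≡0 (p * p * m) (trans (lem p m (+ i) (+ j)) eq)
        where
        lem : ∀ p m i j → p * p * m * (i - j) ≡ p * p * ((1ℤ + m * i) * 1ℤ - (1ℤ + m * j) * 1ℤ)
        lem = solve-∀
      ... | inj₂ i-j≡0 = i≢j (+-injective (i-j≡0⇒i≡j (+ i) (+ j) i-j≡0))
      ... | inj₁ ppm≡0 with i*j≡0⇒i≡0∨j≡0 (p * p) ppm≡0
      ...   | inj₁ pp≡0 = ⊥-elim (p*p≢0 pp≡0)
      ...   | inj₂ m≡0 with i*j≡0⇒i≡0∨j≡0 p m≡0
      ...     | inj₁ p≡0 = p≢0 p≡0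
      ...     | inj₂ ()

    params-generic : ∀ {is} → AllPairs _≢_ is → Generic (map param is)
    params-generic d = AllPairs.map⁺ (AllPairs.map (λ {i} {j} i≢j →
      (A-param i j , B-param i j i≢j) , (A-param j i , B-param j i (λ e → i≢j (sym e)))) d)

  -- The numbers in the lists are labels that select distinct parameters. For every `t`, reducing
  -- `E-inv` shows that the two sides differ by a multiple of `t + 2`; inversion is invisible after
  -- reduction, reversal is not.
  ψ₁-mark : ∀ ls (y : ℕ) rs → AllPairs _≢_ (ls ʳ++ y ∷ rs) → ψ₁ (mark ls rs) ≡ ψ₁ (mark rs ls)
  ψ₁-mark ls y rs distinct = i-j≡0⇒i≡j (ψ₁ (mark ls rs)) (ψ₁ (mark rs ls)) (multiple-of-all⇒0 _ divisible)
    where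
    E-param : ∀ t → E (map (param t) ls) (param t y) (map (param t) rs) ≡
      E (map (inv ∘ param t) rs) (inv (param t y)) (map (inv ∘ param t) ls)
    E-param t = trans
      (E-inv (map (param t) ls) (param t y) (map (param t) rs)
        (subst Generic (map-ʳ++ (param t) ls) (params-generic t distinct)))
      (cong₂ (λ u v → E u (inv (param t y)) v) (sym (map-∘ rs)) (sym (map-∘ ls)))
    divisible : ∀ t → ∃ λ q → ψ₁ (mark ls rs) - ψ₁ (mark rs ls) ≡ + suc (suc t) * q
    divisible t with Reduction.E-≈ p (m t) ls y rs (param t) (param-near t)
                   | Reduction.E-≈ p (m t) rs y ls (inv ∘ param t) (inv-near t)
    ... | q Congruence.by e | q′ Congruence.by e′ = p * (q′ - q) ,
      linear-combination 1ℤ (trans (sym e) (trans (E-param t) e′))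
        (lem (ψ₁ (mark ls rs)) (ψ₁ (mark rs ls)) p (+ suc (suc t)) q q′)
      where
      lem : ∀ u v p s q q′ → u - v ≡ s * (p * (q′ - q)) + 1ℤ * (u + p * s * q - (v + p * s * q′))
      lem = solve-∀

-- The generating function of the line configurations in the variable r

Series : Set
Series = ℕ → ℤ

shift : Series → Series
shift g zero    = 0ℤ
shift g (suc j) = g j

δ : ℕ → Series
δ zero    zero    = 1ℤ
δ zero    (suc j) = 0ℤ
δ (suc i) j       = shift (δ i) j

-- The analogue of `row` in which crossings without a flip have weight 1 and a flip has weight r,
-- multiplication by r being `shift`.
rowSeries : Bool → List Bool → (List Bool → Series) → Series
rowSeries h     []          K j = if h then K [] j else 0ℤ
rowSeries false (false ∷ σ) K j =
  rowSeries false σ (λ τ → K (false ∷ τ)) j + shift (rowSeries true σ (λ τ → K (true ∷ τ))) j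
rowSeries false (true ∷ σ)  K j = rowSeries false σ (λ τ → K (true ∷ τ)) j
rowSeries true  (false ∷ σ) K j = rowSeries true σ (λ τ → K (false ∷ τ)) j
rowSeries true  (true ∷ σ)  K j =
  rowSeries true σ (λ τ → K (true ∷ τ)) j + shift (rowSeries false σ (λ τ → K (false ∷ τ))) j

Φ : ℕ → List Bool → Series
Φ zero    []      = δ 0
Φ zero    (_ ∷ _) = λ _ → 0ℤ
Φ (suc n) []      = λ _ → 0ℤ
Φ (suc n) (h ∷ σ) = rowSeries h σ (Φ n)

Degree≤ : ℕ → Series → Set
Degree≤ n g = ∀ j → n ℕ.< j → g j ≡ 0ℤ

degree-+shift : ∀ {n g g′} → Degree≤ n g → Degree≤ n g′ →
  Degree≤ (suc n) (λ j → g j + shift g′ j)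
degree-+shift d d′ (suc j) (s≤s n<j) = cong₂ _+_ (d (suc j) (ℕ.m≤n⇒m≤1+n n<j)) (d′ j n<j)

degree-suc : ∀ {n g} → Degree≤ n g → Degree≤ (suc n) g
degree-suc d j n<j = d j (ℕ.<-trans (ℕ.n<1+n _) n<j)

rowSeries-degree : ∀ h σ {n K} → (∀ τ → length σ ≡ length τ → Degree≤ n (K τ)) →
  Degree≤ (length σ ℕ.+ n) (rowSeries h σ K)
rowSeries-degree true  []          d = d [] refl
rowSeries-degree false []          d = λ _ _ → refl
rowSeries-degree false (false ∷ σ) d = degree-+shift
  (rowSeries-degree false σ λ τ q → d (false ∷ τ) (cong suc q))
  (rowSeries-degree true σ λ τ q → d (true ∷ τ) (cong suc q))
rowSeries-degree false (true ∷ σ)  d = degree-suc (rowSeries-degree false σ λ τ q → d (true ∷ τ) (cong suc q))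
rowSeries-degree true  (false ∷ σ) d = degree-suc (rowSeries-degree true σ λ τ q → d (false ∷ τ) (cong suc q))
rowSeries-degree true  (true ∷ σ)  d = degree-+shift
  (rowSeries-degree true σ λ τ q → d (true ∷ τ) (cong suc q))
  (rowSeries-degree false σ λ τ q → d (false ∷ τ) (cong suc q))

crossings : ℕ → ℕ
crossings zero    = 0
crossings (suc n) = n ℕ.+ crossings n

-- Each pair of lines crosses once, and a crossing contributes at most one factor r.
Φ-degree : ∀ n σ → n ≡ length σ → Degree≤ (crossings n) (Φ n σ)
Φ-degree zero    []      _ (suc j) _ = refl
Φ-degree (suc n) (h ∷ σ) q with ℕ.suc-injective q
... | refl = rowSeries-degree h σ λ τ q′ → Φ-degree n τ q′

-- Integer specialisations and recovery of the coefficients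

module Evaluation (p : ℤ) (p≢0 : p ≢ 0ℤ) (p∤1 : ∀ u → p * u ≢ 1ℤ) where
  open Homogeneous p p≢0 p∤1
  open Weights p
  open Lines p

  d : ℤ
  d = a unit unit

  -- The value at r = C / d, multiplied by dⁿ.
  eval : ℕ → Series → ℤ
  eval zero    g = g 0
  eval (suc n) g = d * eval n g + g (suc n) * C ^ suc n

  eval-+ : ∀ n g g′ → eval n (λ j → g j + g′ j) ≡ eval n g + eval n g′
  eval-+ zero    g g′ = refl
  eval-+ (suc n) g g′ = trans
    (cong (λ u → d * u + (g (suc n) + g′ (suc n)) * C ^ suc n) (eval-+ n g g′))
    (lem d (eval n g) (eval n g′) (g (suc n)) (g′ (suc n)) (C ^ suc n))
    where
    lem : ∀ d u v x y c → d * (u + v) + (x + y) * c ≡ d * u + x * c + (d * v + y * c)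
    lem = solve-∀

  eval-neg : ∀ n g → eval n (λ j → - g j) ≡ - eval n g
  eval-neg zero    g = refl
  eval-neg (suc n) g = trans (cong (λ u → d * u + - g (suc n) * C ^ suc n) (eval-neg n g))
    (lem d (eval n g) (g (suc n)) (C ^ suc n))
    where
    lem : ∀ d u x c → d * (- u) + - x * c ≡ - (d * u + x * c)
    lem = solve-∀

  eval-suc : ∀ n g → Degree≤ n g → eval (suc n) g ≡ d * eval n g
  eval-suc n g deg = trans (cong (λ u → d * eval n g + u * C ^ suc n) (deg (suc n) (ℕ.n<1+n n)))
    (+-identityʳ (d * eval n g))

  eval-shift : ∀ n g → eval (suc n) (shift g) ≡ C * eval n g
  eval-shift zero    g = lem d (g 0) C
    where
    lem : ∀ d g c → d * 0ℤ + g * (c * 1ℤ) ≡ c * g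
    lem = solve-∀
  eval-shift (suc n) g = trans (cong (λ u → d * u + g (suc n) * C ^ suc (suc n)) (eval-shift n g))
    (lem d C (eval n g) (g (suc n)) (C ^ suc n))
    where
    lem : ∀ d c u x k → d * (c * u) + x * (c * k) ≡ c * (d * u + x * k)
    lem = solve-∀

  eval-+shift : ∀ n {g g′ u u′} → Degree≤ n g → eval n g ≡ u → eval n g′ ≡ u′ →
    eval (suc n) (λ j → g j + shift g′ j) ≡ d * u + C * u′
  eval-+shift n {g} {g′} deg refl refl = trans (eval-+ (suc n) g (shift g′))
    (cong₂ _+_ (eval-suc n g deg) (eval-shift n g′))

  opaque
    unfolding a b n

    b-unit : b unit unit ≡ d
    b-unit = refl

    n-unit : n unit * n unit ≡ 1ℤ
    n-unit = refl

  -- Every crossing raises the homogenising exponent by one. Without a flip it contributes `d`,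
  -- because `a` and `b` agree at `unit`; with a flip it contributes `C`.
  rowSeries-eval : ∀ h σ {k K L} → (∀ τ → length σ ≡ length τ → Degree≤ k (K τ)) →
    (∀ τ → length σ ≡ length τ → eval k (K τ) ≡ L τ) →
    eval (length σ ℕ.+ k) (rowSeries h σ K) ≡ row unit h (map (const unit) σ) σ L
  rowSeries-eval true  []      deg e = e [] refl
  rowSeries-eval false []      {k} deg e = eval-zero k
    where
    eval-zero : ∀ n → eval n (λ _ → 0ℤ) ≡ 0ℤ
    eval-zero zero    = refl
    eval-zero (suc n) = trans (cong (λ u → d * u + 0ℤ) (eval-zero n)) (trans (+-identityʳ (d * 0ℤ)) (*-zeroʳ d))
  rowSeries-eval false (false ∷ σ) deg e = eval-+shift _
    (rowSeries-degree false σ λ τ q → deg (false ∷ τ) (cong suc q))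
    (rowSeries-eval false σ (λ τ q → deg (false ∷ τ) (cong suc q)) (λ τ q → e (false ∷ τ) (cong suc q)))
    (rowSeries-eval true σ (λ τ q → deg (true ∷ τ) (cong suc q)) (λ τ q → e (true ∷ τ) (cong suc q)))
  rowSeries-eval false (true ∷ σ) deg e rewrite b-unit = trans
    (eval-suc _ _ (rowSeries-degree false σ λ τ q → deg (true ∷ τ) (cong suc q)))
    (cong (d *_) (rowSeries-eval false σ
      (λ τ q → deg (true ∷ τ) (cong suc q)) (λ τ q → e (true ∷ τ) (cong suc q))))
  rowSeries-eval true (false ∷ σ) deg e rewrite b-unit = trans
    (eval-suc _ _ (rowSeries-degree true σ λ τ q → deg (false ∷ τ) (cong suc q)))
    (cong (d *_) (rowSeries-eval true σ
      (λ τ q → deg (false ∷ τ) (cong suc q)) (λ τ q → e (false ∷ τ) (cong suc q))))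
  rowSeries-eval true (true ∷ σ) deg e rewrite n-unit | *-identityʳ C = eval-+shift _
    (rowSeries-degree true σ λ τ q → deg (true ∷ τ) (cong suc q))
    (rowSeries-eval true σ (λ τ q → deg (true ∷ τ) (cong suc q)) (λ τ q → e (true ∷ τ) (cong suc q)))
    (rowSeries-eval false σ (λ τ q → deg (false ∷ τ) (cong suc q)) (λ τ q → e (false ∷ τ) (cong suc q)))

  Φ-eval : ∀ n σ → n ≡ length σ → eval (crossings n) (Φ n σ) ≡ ψ₁ σ
  Φ-eval zero    []      _ = refl
  Φ-eval (suc n) (h ∷ σ) q with ℕ.suc-injective q
  ... | refl = rowSeries-eval h σ (λ τ q′ → Φ-degree n τ q′) λ τ q′ → trans (Φ-eval n τ q′)
    (cong (λ xs → ψ xs τ) (map-const unit τ σ (sym q′)))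

  opaque
    unfolding a C

    d-multiple : d ≡ p * (p * p * 1ℤ - 1ℤ)
    d-multiple = refl

    d≢0 : d ≢ 0ℤ
    d≢0 eq with i*j≡0⇒i≡0∨j≡0 p eq
    ... | inj₁ p≡0 = p≢0 p≡0
    ... | inj₂ p²-1≡0 = p∤1 p (trans (sym (*-identityʳ (p * p))) (i-j≡0⇒i≡j (p * p * 1ℤ) 1ℤ p²-1≡0))

    -- `C` is congruent to -1 modulo `p`, so `w` is the k-th power of -1.
    C-invertible : ∀ k → ∃ λ w → ∃ λ u → C ^ k * w ≡ 1ℤ + p * u
    C-invertible zero = 1ℤ , 0ℤ , lem p
      where
      lem : ∀ p → 1ℤ * 1ℤ ≡ 1ℤ + p * 0ℤ
      lem = solve-∀
    C-invertible (suc k) with C-invertible k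
    ... | w , u , e = - w , u - p * p * p - p * u * (p * p * p) ,
      linear-combination (- C) e (lem p (C ^ k) w u)
      where
      lem : ∀ p c w u → (p * p * (p * p) - 1ℤ) * c * (- w) ≡
        1ℤ + p * (u - p * p * p - p * u * (p * p * p)) + (- (p * p * (p * p) - 1ℤ)) * (c * w - (1ℤ + p * u))
      lem = solve-∀

  -- p divides d but is prime to C.
  leading-multiple : ∀ n g → eval (suc n) g ≡ 0ℤ → ∃ λ q → g (suc n) ≡ p * q
  leading-multiple n g eq with C-invertible (suc n)
  ... | w , u , e = - ((p * p * 1ℤ - 1ℤ) * eval n g * w) - g (suc n) * u ,
    linear-combination w (subst (λ t → t * eval n g + g (suc n) * C ^ suc n ≡ 0ℤ) d-multiple eq)
      (linear-combination (- g (suc n)) e (lem p (eval n g) (g (suc n)) (C ^ suc n) w u))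
    where
    lem : ∀ p v x c w u → x ≡ p * (- ((p * p * 1ℤ - 1ℤ) * v * w) - x * u)
      + w * (p * (p * p * 1ℤ - 1ℤ) * v + x * c - 0ℤ) + (- x) * (c * w - (1ℤ + p * u))
    lem = solve-∀

  eval-lower : ∀ n g → g (suc n) ≡ 0ℤ → eval (suc n) g ≡ 0ℤ → eval n g ≡ 0ℤ
  eval-lower n g leading≡0 eq with i*j≡0⇒i≡0∨j≡0 d
    (trans (sym (+-identityʳ (d * eval n g)))
      (trans (cong (λ u → d * eval n g + u * C ^ suc n) (sym leading≡0)) eq))
  ... | inj₁ d≡0    = ⊥-elim (d≢0 d≡0)
  ... | inj₂ eval≡0 = eval≡0

  Φ-mark-eval : ∀ n (ls : List ℕ) y rs → AllPairs _≢_ (ls ʳ++ y ∷ rs) →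
    n ≡ length (mark ls rs) → n ≡ length (mark rs ls) →
    eval (crossings n) (λ j → Φ n (mark ls rs) j - Φ n (mark rs ls) j) ≡ 0ℤ
  Φ-mark-eval n ls y rs distinct size size′ = begin
    eval (crossings n) (λ j → Φ n (mark ls rs) j - Φ n (mark rs ls) j)
      ≡⟨ eval-+ (crossings n) (Φ n (mark ls rs)) (λ j → - Φ n (mark rs ls) j) ⟩
    eval (crossings n) (Φ n (mark ls rs)) + eval (crossings n) (λ j → - Φ n (mark rs ls) j)
      ≡⟨ cong₂ _+_ (trans (Φ-eval n (mark ls rs) size) (ψ₁-mark ls y rs distinct))
           (trans (eval-neg (crossings n) (Φ n (mark rs ls))) (cong -_ (Φ-eval n (mark rs ls) size′))) ⟩
    ψ₁ (mark rs ls) - ψ₁ (mark rs ls)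
      ≡⟨ +-inverseʳ (ψ₁ (mark rs ls)) ⟩
    0ℤ ∎
    where open ≡-Reasoning

p≢0 : ∀ p′ → + suc (suc p′) ≢ 0ℤ
p≢0 p′ ()

p∤1 : ∀ p′ u → + suc (suc p′) * u ≢ 1ℤ
p∤1 p′ u eq with ℕ.m*n≡1⇒m≡1 (suc (suc p′)) ∣ u ∣
  (trans (sym (abs-* (+ suc (suc p′)) u)) (cong ∣_∣ eq))
... | ()

module Eval (p′ : ℕ) = Evaluation (+ suc (suc p′)) (p≢0 p′) (p∤1 p′)

-- Coefficients are removed from the top: the leading one is a multiple of every integer from 2 on,
-- hence 0, and then the nonzero factor `d` cancels.
eval-faithful : ∀ n g → (∀ p′ → Eval.eval p′ n g ≡ 0ℤ) → ∀ j → j ℕ.≤ n → g j ≡ 0ℤ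
eval-faithful zero    g e zero z≤n = e 0
eval-faithful (suc n) g e j j≤1+n = by-cases (ℕ.m≤n⇒m<n∨m≡n j≤1+n)
  where
  leading≡0 : g (suc n) ≡ 0ℤ
  leading≡0 = multiple-of-all⇒0 (g (suc n)) λ p′ → Eval.leading-multiple p′ n g (e p′)
  lower : ∀ p′ → Eval.eval p′ n g ≡ 0ℤ
  lower p′ = Eval.eval-lower p′ n g leading≡0 (e p′)
  by-cases : j ℕ.< suc n ⊎ j ≡ suc n → g j ≡ 0ℤ
  by-cases (inj₁ (s≤s j≤n)) = eval-faithful n g lower j j≤n
  by-cases (inj₂ refl)      = leading≡0

Φ-mark : ∀ n (ls : List ℕ) y rs → AllPairs _≢_ (ls ʳ++ y ∷ rs) → n ≡ length (mark ls rs) →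
  ∀ j → Φ n (mark ls rs) j ≡ Φ n (mark rs ls) j
Φ-mark n ls y rs distinct size j = by-cases (j ℕ.≤? crossings n)
  where
  size′ : n ≡ length (mark rs ls)
  size′ = trans size (trans (length-mark ls rs)
    (trans (cong suc (ℕ.+-comm (length ls) (length rs))) (sym (length-mark rs ls))))
  by-cases : Dec (j ℕ.≤ crossings n) → Φ n (mark ls rs) j ≡ Φ n (mark rs ls) j
  by-cases (yes j≤) = i-j≡0⇒i≡j (Φ n (mark ls rs) j) (Φ n (mark rs ls) j) (eval-faithful (crossings n)
    (λ j → Φ n (mark ls rs) j - Φ n (mark rs ls) j)
    (λ p′ → Eval.Φ-mark-eval p′ n ls y rs distinct size size′) j j≤)
  by-cases (no j≰) = trans (Φ-degree n (mark ls rs) size j (ℕ.≰⇒> j≰))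
    (sym (Φ-degree n (mark rs ls) size′ j (ℕ.≰⇒> j≰)))

-- Sums over lists of vectors and matrices

∑ : List X → (X → ℤ) → ℤ
∑ []       f = 0ℤ
∑ (x ∷ xs) f = f x + ∑ xs f

∑-cong : ∀ (xs : List X) {f g} → (∀ x → f x ≡ g x) → ∑ xs f ≡ ∑ xs g
∑-cong []       e = refl
∑-cong (x ∷ xs) e = cong₂ _+_ (e x) (∑-cong xs e)

∑-zero : ∀ (xs : List X) {f} → (∀ x → f x ≡ 0ℤ) → ∑ xs f ≡ 0ℤ
∑-zero []       e = refl
∑-zero (x ∷ xs) e = cong₂ _+_ (e x) (∑-zero xs e)

∑-++ : ∀ (xs ys : List X) f → ∑ (xs ++ ys) f ≡ ∑ xs f + ∑ ys f
∑-++ []       ys f = sym (+-identityˡ (∑ ys f))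
∑-++ (x ∷ xs) ys f = trans (cong (λ t → f x + t) (∑-++ xs ys f)) (sym (+-assoc (f x) (∑ xs f) (∑ ys f)))

∑-map : ∀ (h : X → Y) xs f → ∑ (map h xs) f ≡ ∑ xs (f ∘ h)
∑-map h []       f = refl
∑-map h (x ∷ xs) f = cong (λ t → f (h x) + t) (∑-map h xs f)

∑-concatMap : ∀ (h : X → List Y) xs f → ∑ (concatMap h xs) f ≡ ∑ xs (λ x → ∑ (h x) f)
∑-concatMap h []       f = refl
∑-concatMap h (x ∷ xs) f = trans (∑-++ (h x) (concatMap h xs) f)
  (cong (λ t → ∑ (h x) f + t) (∑-concatMap h xs f))

∑-+ : ∀ (xs : List X) f g → ∑ xs (λ x → f x + g x) ≡ ∑ xs f + ∑ xs g
∑-+ []       f g = refl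
∑-+ (x ∷ xs) f g = trans (cong (λ t → f x + g x + t) (∑-+ xs f g)) (lem (f x) (g x) (∑ xs f) (∑ xs g))
  where
  lem : ∀ u v w z → u + v + (w + z) ≡ u + w + (v + z)
  lem = solve-∀

∑-swap : ∀ (xs : List X) (ys : List Y) (f : X → Y → ℤ) →
  ∑ xs (λ x → ∑ ys (f x)) ≡ ∑ ys (λ y → ∑ xs (λ x → f x y))
∑-swap []       ys f = sym (∑-zero ys λ _ → refl)
∑-swap (x ∷ xs) ys f = trans (cong (λ t → ∑ ys (f x) + t) (∑-swap xs ys f))
  (sym (∑-+ ys (f x) (λ y → ∑ xs (λ x → f x y))))

∑-*ˡ : ∀ c (xs : List X) f → ∑ xs (λ x → c * f x) ≡ c * ∑ xs f
∑-*ˡ c []       f = sym (*-zeroʳ c)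
∑-*ˡ c (x ∷ xs) f = trans (cong (λ t → c * f x + t) (∑-*ˡ c xs f)) (sym (*-distribˡ-+ c (f x) (∑ xs f)))

χ : Bool → ℤ
χ b = if b then 1ℤ else 0ℤ

χ-∧ : ∀ b c → χ (b ∧ c) ≡ χ b * χ c
χ-∧ true  c = sym (*-identityˡ (χ c))
χ-∧ false c = refl

∑-filterᵇ : ∀ (q : X → Bool) xs f → ∑ (filterᵇ q xs) f ≡ ∑ xs (λ x → χ (q x) * f x)
∑-filterᵇ q []       f = refl
∑-filterᵇ q (x ∷ xs) f with q x
... | true  = cong₂ _+_ (sym (*-identityˡ (f x))) (∑-filterᵇ q xs f)
... | false = trans (∑-filterᵇ q xs f) (sym (+-identityˡ _))

length-filterᵇ : ∀ (q : X → Bool) xs → + length (filterᵇ q xs) ≡ ∑ xs (χ ∘ q)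
length-filterᵇ q []       = refl
length-filterᵇ q (x ∷ xs) with q x
... | true  = cong (λ t → 1ℤ + t) (length-filterᵇ q xs)
... | false = trans (length-filterᵇ q xs) (sym (+-identityˡ _))

∑-vecs : ∀ (xs : List X) m (f : Vec X (suc m) → ℤ) →
  ∑ (vecsOver xs (suc m)) f ≡ ∑ xs (λ x → ∑ (vecsOver xs m) (λ v → f (x ∷ v)))
∑-vecs xs m f = trans (∑-concatMap (λ x → map (x ∷_) (vecsOver xs m)) xs f)
  (∑-cong xs λ x → ∑-map (x ∷_) (vecsOver xs m) f)

∑-columns : ∀ (xs : List X) k m f → ∑ (vecsOver (vecsOver xs (suc k)) m) f ≡
  ∑ (vecsOver xs m) (λ c → ∑ (vecsOver (vecsOver xs k) m) (λ B → f (zipWith _∷_ c B)))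
∑-columns xs k zero    f = sym (+-identityʳ _)
∑-columns xs k (suc m) f = begin
  ∑ (vecsOver (vecsOver xs (suc k)) (suc m)) f
    ≡⟨ ∑-vecs (vecsOver xs (suc k)) m f ⟩
  ∑ (vecsOver xs (suc k)) (λ r → ∑ (vecsOver (vecsOver xs (suc k)) m) (λ A → f (r ∷ A)))
    ≡⟨ ∑-vecs xs k _ ⟩
  ∑ xs (λ x → ∑ (vecsOver xs k) (λ r → ∑ (vecsOver (vecsOver xs (suc k)) m) (λ A → f ((x ∷ r) ∷ A))))
    ≡⟨ ∑-cong xs (λ x → ∑-cong (vecsOver xs k) (λ r → ∑-columns xs k m (λ A → f ((x ∷ r) ∷ A)))) ⟩
  ∑ xs (λ x → ∑ (vecsOver xs k) (λ r → ∑ (vecsOver xs m) (λ c →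
    ∑ (vecsOver (vecsOver xs k) m) (λ B → f ((x ∷ r) ∷ zipWith _∷_ c B)))))
    ≡⟨ ∑-cong xs (λ x → ∑-swap (vecsOver xs k) (vecsOver xs m) _) ⟩
  ∑ xs (λ x → ∑ (vecsOver xs m) (λ c → ∑ (vecsOver xs k) (λ r →
    ∑ (vecsOver (vecsOver xs k) m) (λ B → f ((x ∷ r) ∷ zipWith _∷_ c B)))))
    ≡⟨ ∑-cong xs (λ x → ∑-cong (vecsOver xs m) (λ c → ∑-vecs (vecsOver xs k) m _)) ⟨
  ∑ xs (λ x → ∑ (vecsOver xs m) (λ c → ∑ (vecsOver (vecsOver xs k) (suc m)) (λ B → f (zipWith _∷_ (x ∷ c) B))))
    ≡⟨ ∑-vecs xs m _ ⟨
  ∑ (vecsOver xs (suc m)) (λ c → ∑ (vecsOver (vecsOver xs k) (suc m)) (λ B → f (zipWith _∷_ c B))) ∎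
  where open ≡-Reasoning

eqv : ∀ {m} → Vec ℤ m → Vec ℤ m → Bool
eqv []      []      = true
eqv (x ∷ v) (y ∷ w) = (x == y) ∧ eqv v w

rowVecs : (m : ℕ) → List (Vec ℤ m)
rowVecs = vecsOver entries

∑-entries-diagonal : ∀ (D : ℤ → ℤ → ℤ) → (∀ x y → (x == y) ≡ false → D x y ≡ 0ℤ) →
  ∑ entries (λ x → ∑ entries (D x)) ≡ ∑ entries (λ x → D x x)
∑-entries-diagonal D off
  rewrite off -[1+ 0 ] 0ℤ refl | off -[1+ 0 ] 1ℤ refl | off 0ℤ -[1+ 0 ] refl
        | off 0ℤ 1ℤ refl | off 1ℤ -[1+ 0 ] refl | off 1ℤ 0ℤ refl =
  lem (D -[1+ 0 ] -[1+ 0 ]) (D 0ℤ 0ℤ) (D 1ℤ 1ℤ)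
  where
  lem : ∀ u v w → u + 0ℤ + (0ℤ + (v + 0ℤ) + (0ℤ + (0ℤ + (w + 0ℤ)) + 0ℤ)) ≡ u + (v + (w + 0ℤ))
  lem = solve-∀

==-refl : ∀ x → (x == x) ≡ true
==-refl x with x ≟ x
... | yes _  = refl
... | no x≢x = contradiction refl x≢x

-- For a symmetric matrix this collapses the sum over first row and first column to a sum over the
-- first row.
∑-diagonal : ∀ m (F : Vec ℤ m → Vec ℤ m → ℤ) →
  ∑ (rowVecs m) (λ v → ∑ (rowVecs m) (λ w → χ (eqv v w) * F v w)) ≡ ∑ (rowVecs m) (λ v → F v v)
∑-diagonal zero    F = cong (λ t → t + 0ℤ) (trans (+-identityʳ _) (*-identityˡ (F [] [])))
∑-diagonal (suc m) F = begin
  ∑ (rowVecs (suc m)) (λ v → ∑ (rowVecs (suc m)) (H v))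
    ≡⟨ ∑-vecs entries m (λ v → ∑ (rowVecs (suc m)) (H v)) ⟩
  ∑ entries (λ x → ∑ (rowVecs m) (λ v → ∑ (rowVecs (suc m)) (H (x ∷ v))))
    ≡⟨ ∑-cong entries (λ x → ∑-cong (rowVecs m) (λ v → ∑-vecs entries m (H (x ∷ v)))) ⟩
  ∑ entries (λ x → ∑ (rowVecs m) (λ v → ∑ entries (λ y → ∑ (rowVecs m) (λ w → H (x ∷ v) (y ∷ w)))))
    ≡⟨ ∑-cong entries (λ x → ∑-swap (rowVecs m) entries (λ v y → ∑ (rowVecs m) (λ w → H (x ∷ v) (y ∷ w)))) ⟩
  ∑ entries (λ x → ∑ entries (λ y → D x y))
    ≡⟨ ∑-entries-diagonal D off ⟩
  ∑ entries (λ x → D x x)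
    ≡⟨ ∑-cong entries (λ x → trans
         (∑-cong (rowVecs m) (λ v → ∑-cong (rowVecs m) (λ w →
           cong (λ b → χ (b ∧ eqv v w) * F (x ∷ v) (x ∷ w)) (==-refl x))))
         (∑-diagonal m (λ v w → F (x ∷ v) (x ∷ w)))) ⟩
  ∑ entries (λ x → ∑ (rowVecs m) (λ v → F (x ∷ v) (x ∷ v)))
    ≡⟨ ∑-vecs entries m (λ v → F v v) ⟨
  ∑ (rowVecs (suc m)) (λ v → F v v) ∎
  where
  open ≡-Reasoning
  H : Vec ℤ (suc m) → Vec ℤ (suc m) → ℤ
  H v w = χ (eqv v w) * F v w
  D : ℤ → ℤ → ℤ
  D x y = ∑ (rowVecs m) (λ v → ∑ (rowVecs m) (λ w → H (x ∷ v) (y ∷ w)))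
  off : ∀ x y → (x == y) ≡ false → D x y ≡ 0ℤ
  off x y e = ∑-zero (rowVecs m) λ v → ∑-zero (rowVecs m) λ w →
    cong (λ b → χ (b ∧ eqv v w) * F (x ∷ v) (y ∷ w)) e

-- OSASMs as line configurations

step : Bool → ℤ → Maybe Bool
step false (+ 0)             = just false
step false (+ 1)             = just true
step false (+ suc (suc _))   = nothing
step false -[1+ _ ]          = nothing
step true  (+ 0)             = just true
step true  (+ suc _)         = nothing
step true  -[1+ 0 ]          = just false
step true  -[1+ suc _ ]      = nothing

walk : Bool → List ℤ → Bool
walk h []      = h
walk h (x ∷ l) = maybe (λ h′ → walk h′ l) false (step h x)

==-cong : ∀ {x y x′ y′} → (x ≡ y → x′ ≡ y′) → (x′ ≡ y′ → x ≡ y) →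
  (x == y) ≡ (x′ == y′)
==-cong {x} {y} {x′} {y′} f g with x ≟ y | x′ ≟ y′
... | yes _   | yes _   = refl
... | no _    | no _    = refl
... | yes x≡y | no x′≢y′ = contradiction (f x≡y) x′≢y′
... | no x≢y  | yes x′≡y′ = contradiction (g x′≡y′) x≢y

==-+ : ∀ c x y → ((c + x) == (c + y)) ≡ (x == y)
==-+ c x y = ==-cong (+-cancelˡ c x y) (cong (λ t → c + t))

-- `s` is the last nonzero entry read and `t` the sum still to come. State 0 corresponds to
-- `s = −1`, `t = 1`, and state 1 to `s = 1`, `t = 0`.
signLine : ℤ → ℤ → List ℤ → Bool
signLine s t l = allB isEntry l ∧ (alternates (s ∷ nonzeros l) ∧ (sumℤ (nonzeros l) == t))

signLine-1 : ∀ t l → signLine -[1+ 0 ] (1ℤ + t) (1ℤ ∷ l) ≡ signLine 1ℤ t l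
signLine-1 t l = cong (λ b → allB isEntry l ∧ (alternates (1ℤ ∷ nonzeros l) ∧ b)) (==-+ 1ℤ _ t)

signLine-−1 : ∀ t l → signLine 1ℤ (-[1+ 0 ] + t) (-[1+ 0 ] ∷ l) ≡ signLine -[1+ 0 ] t l
signLine-−1 t l = cong (λ b → allB isEntry l ∧ (alternates (-[1+ 0 ] ∷ nonzeros l) ∧ b)) (==-+ -[1+ 0 ] _ t)

-- An alternating word that follows a −1 has sum 0 or 1, and one that follows a 1 has sum 0 or −1.
signLine-2 : ∀ l → signLine -[1+ 0 ] (+ 2) l ≡ false
signLine-1′ : ∀ l → signLine 1ℤ 1ℤ l ≡ false
signLine-2 []                    = refl
signLine-2 (+ 0 ∷ l)             = signLine-2 l
signLine-2 (+ 1 ∷ l)             = trans (signLine-1 1ℤ l) (signLine-1′ l)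
signLine-2 (+ suc (suc _) ∷ l)   = refl
signLine-2 (-[1+ 0 ] ∷ l)        = ∧-zeroʳ (allB isEntry l)
signLine-2 (-[1+ suc _ ] ∷ l)    = refl
signLine-1′ []                   = refl
signLine-1′ (+ 0 ∷ l)            = signLine-1′ l
signLine-1′ (+ 1 ∷ l)            = ∧-zeroʳ (allB isEntry l)
signLine-1′ (+ suc (suc _) ∷ l)  = refl
signLine-1′ (-[1+ 0 ] ∷ l)       = trans (signLine-−1 (+ 2) l) (signLine-2 l)
signLine-1′ (-[1+ suc _ ] ∷ l)   = refl

signLine-false : ∀ l → signLine -[1+ 0 ] 1ℤ l ≡ walk false l
signLine-true  : ∀ l → signLine 1ℤ 0ℤ l ≡ walk true l
signLine-false []                   = refl
signLine-false (+ 0 ∷ l)            = signLine-false l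
signLine-false (+ 1 ∷ l)            = trans (signLine-1 0ℤ l) (signLine-true l)
signLine-false (+ suc (suc _) ∷ l)  = refl
signLine-false (-[1+ 0 ] ∷ l)       = ∧-zeroʳ (allB isEntry l)
signLine-false (-[1+ suc _ ] ∷ l)   = refl
signLine-true []                    = refl
signLine-true (+ 0 ∷ l)             = signLine-true l
signLine-true (+ 1 ∷ l)             = ∧-zeroʳ (allB isEntry l)
signLine-true (+ suc (suc _) ∷ l)   = refl
signLine-true (-[1+ 0 ] ∷ l)        = trans (signLine-−1 1ℤ l) (signLine-false l)
signLine-true (-[1+ suc _ ] ∷ l)    = refl

isASMLine≡walk : ∀ l → isASMLine l ≡ walk false l
isASMLine≡walk []                  = refl
isASMLine≡walk (+ 0 ∷ l)           = isASMLine≡walk l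
isASMLine≡walk (+ 1 ∷ l)           = signLine-false (1ℤ ∷ l)
isASMLine≡walk (+ suc (suc _) ∷ l) = refl
-- Alternation alone permits an initial -1, but the remaining entries would then have to sum to 2.
isASMLine≡walk (-[1+ 0 ] ∷ l)      = trans
  (cong (λ b → allB isEntry l ∧ (alternates (-[1+ 0 ] ∷ nonzeros l) ∧ b))
    (==-+ -[1+ 0 ] (sumℤ (nonzeros l)) (+ 2)))
  (signLine-2 l)
isASMLine≡walk (-[1+ suc _ ] ∷ l)  = refl

allB-cong : ∀ {p q : X → Bool} (xs : List X) → (∀ x → p x ≡ q x) → allB p xs ≡ allB q xs
allB-cong []       e = refl
allB-cong (x ∷ xs) e = cong₂ _∧_ (e x) (allB-cong xs e)

allB-map : ∀ (p : Y → Bool) (f : X → Y) xs → allB p (map f xs) ≡ allB (p ∘ f) xs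
allB-map p f []       = refl
allB-map p f (x ∷ xs) = cong (p (f x) ∧_) (allB-map p f xs)

∧-exchange : ∀ a b c d → (a ∧ b) ∧ (c ∧ d) ≡ (a ∧ c) ∧ (b ∧ d)
∧-exchange false b c d = refl
∧-exchange true  false c d = sym (∧-zeroʳ c)
∧-exchange true  true c d = refl

allB-∧ : ∀ (p q : X → Bool) xs → allB (λ x → p x ∧ q x) xs ≡ allB p xs ∧ allB q xs
allB-∧ p q []       = refl
allB-∧ p q (x ∷ xs) = trans (cong ((p x ∧ q x) ∧_) (allB-∧ p q xs)) (∧-exchange (p x) (q x) _ _)

allB-suc : ∀ {m} (p : Fin (suc m) → Bool) → allB p (allFin (suc m)) ≡ p zero ∧ allB (p ∘ suc) (allFin m)
allB-suc {m} p = cong (p zero ∧_) (trans (cong (allB p) (sym (map-tabulate id suc))) (allB-map p suc (allFin m)))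

allB-lookup : ∀ {m} (p : Fin m → Bool) → allB p (allFin m) ≡ true → ∀ i → p i ≡ true
allB-lookup {suc m} p e i with trans (sym (allB-suc p)) e
... | e′ with p zero in p0 | e′
allB-lookup {suc m} p e zero    | _ | true | _  = p0
allB-lookup {suc m} p e (suc i) | _ | true | e″ = allB-lookup (p ∘ suc) e″ i

==⇒≡ : ∀ {x y} → (x == y) ≡ true → x ≡ y
==⇒≡ {x} {y} e with x ≟ y
... | yes x≡y = x≡y

==-sym : ∀ x y → (x == y) ≡ (y == x)
==-sym x y = ==-cong sym sym

-- Removal of the first row and column

peel : ∀ {m} → ℤ → Vec ℤ m → Vec ℤ m → Matrix m → Matrix (suc m)
peel x v c B = (x ∷ v) ∷ zipWith _∷_ c B

entry-left : ∀ {m} x v c (B : Matrix m) i → entry (peel x v c B) (suc i) zero ≡ lookup c i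
entry-left x v c B i = cong (λ r → lookup r zero) (Vec.lookup-zipWith _∷_ i c B)

entry-inner : ∀ {m} x v c (B : Matrix m) i j → entry (peel x v c B) (suc i) (suc j) ≡ entry B i j
entry-inner x v c B i j = cong (λ r → lookup r (suc j)) (Vec.lookup-zipWith _∷_ i c B)

allB-eqv : ∀ {m} (v w : Vec ℤ m) → allB (λ i → lookup v i == lookup w i) (allFin m) ≡ eqv v w
allB-eqv []      []      = refl
allB-eqv (x ∷ v) (y ∷ w) = trans (allB-suc (λ i → lookup (x ∷ v) i == lookup (y ∷ w) i))
  (cong ((x == y) ∧_) (allB-eqv v w))

isSymmetric-peel : ∀ {m} x v c (B : Matrix m) → isSymmetric (peel x v c B) ≡ eqv v c ∧ isSymmetric B
isSymmetric-peel {m} x v c B = begin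
  isSymmetric A
    ≡⟨ allB-suc (λ i → allB (sym? i) (allFin (suc m))) ⟩
  allB (sym? zero) (allFin (suc m)) ∧ allB (λ i → allB (sym? (suc i)) (allFin (suc m))) (allFin m)
    ≡⟨ cong₂ _∧_ top rest ⟩
  eqv v c ∧ (eqv v c ∧ isSymmetric B)
    ≡⟨ ∧-assoc (eqv v c) (eqv v c) (isSymmetric B) ⟨
  (eqv v c ∧ eqv v c) ∧ isSymmetric B
    ≡⟨ cong (_∧ isSymmetric B) (∧-idem (eqv v c)) ⟩
  eqv v c ∧ isSymmetric B ∎
  where
  open ≡-Reasoning
  A : Matrix (suc m)
  A = peel x v c B
  sym? : Fin (suc m) → Fin (suc m) → Bool
  sym? i j = entry A i j == entry A j i
  top : allB (sym? zero) (allFin (suc m)) ≡ eqv v c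
  top = trans (allB-suc (sym? zero)) (trans (cong (_∧ allB (sym? zero ∘ suc) (allFin m)) (==-refl x))
    (trans (allB-cong (allFin m) (λ j → cong (lookup v j ==_) (entry-left x v c B j))) (allB-eqv v c)))
  rest : allB (λ i → allB (sym? (suc i)) (allFin (suc m))) (allFin m) ≡ eqv v c ∧ isSymmetric B
  rest = trans
    (allB-cong (allFin m) (λ i → trans (allB-suc (sym? (suc i))) (cong₂ _∧_
      (trans (cong (_== lookup v i) (entry-left x v c B i)) (==-sym (lookup c i) (lookup v i)))
      (allB-cong (allFin m) (λ j → cong₂ _==_ (entry-inner x v c B i j) (entry-inner x v c B j i))))))
    (trans (allB-∧ (λ i → lookup v i == lookup c i)
        (λ i → allB (λ j → entry B i j == entry B j i) (allFin m)) (allFin m))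
      (cong (_∧ isSymmetric B) (allB-eqv v c)))

zeroDiagonal-peel : ∀ {m} x v c (B : Matrix m) → zeroDiagonal (peel x v c B) ≡ (x == 0ℤ) ∧ zeroDiagonal B
zeroDiagonal-peel {m} x v c B = trans (allB-suc (λ i → entry (peel x v c B) i i == 0ℤ))
  (cong ((x == 0ℤ) ∧_) (allB-cong (allFin m) (λ i → cong (_== 0ℤ) (entry-inner x v c B i i))))

walks : ∀ {k m} → Vec Bool k → Vec (Vec ℤ m) k → Bool
walks []      []      = true
walks (h ∷ σ) (r ∷ A) = walk h (toList r) ∧ walks σ A

-- Describes the lower right block of an OSASM: `σ` holds the partial sums of its rows over the
-- columns already removed. Column conditions are omitted because symmetry makes them repeat the row
-- conditions.
good : ∀ {m} → Vec Bool m → Matrix m → Bool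
good σ A = isSymmetric A ∧ (zeroDiagonal A ∧ walks σ A)

walks-lines : ∀ {k m} (A : Vec (Vec ℤ m) k) →
  allB (λ r → isASMLine (toList r)) (toList A) ≡ walks (Vec.replicate k false) A
walks-lines []      = refl
walks-lines (r ∷ A) = cong₂ _∧_ (isASMLine≡walk (toList r)) (walks-lines A)

transpose-row : ∀ {k m} (r : Vec ℤ m) (A : Vec (Vec ℤ m) k) j →
  lookup (transpose (r ∷ A)) j ≡ lookup r j ∷ lookup (transpose A) j
transpose-row {k} {m} r A j = trans
  (Vec.lookup-⊛ j (Vec.replicate m push Vec.⊛ r) (transpose A))
  (cong (λ f → f (lookup (transpose A) j)) (trans
    (Vec.lookup-⊛ j (Vec.replicate m push) r)
    (cong (λ f → f (lookup r j)) (Vec.lookup-replicate j push))))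
  where
  push : ℤ → Vec ℤ k → Vec ℤ (suc k)
  push = _∷_

lookup-transpose : ∀ {k m} (A : Vec (Vec ℤ m) k) i j → lookup (lookup (transpose A) j) i ≡ lookup (lookup A i) j
lookup-transpose (r ∷ A) zero    j = cong (λ w → lookup w zero) (transpose-row r A j)
lookup-transpose (r ∷ A) (suc i) j = trans
  (cong (λ w → lookup w (suc i)) (transpose-row r A j)) (lookup-transpose A i j)

lookup-ext : ∀ {m} {v w : Vec X m} → (∀ i → lookup v i ≡ lookup w i) → v ≡ w
lookup-ext {v = v} {w} e = trans (sym (Vec.tabulate∘lookup v)) (trans (Vec.tabulate-cong e) (Vec.tabulate∘lookup w))

transpose-symmetric : ∀ {m} (A : Matrix m) → isSymmetric A ≡ true → transpose A ≡ A
transpose-symmetric {m} A e = lookup-ext λ j → lookup-ext λ i → trans (lookup-transpose A i j)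
  (==⇒≡ (allB-lookup (λ j → entry A i j == entry A j i)
    (allB-lookup (λ i → allB (λ j → entry A i j == entry A j i) (allFin m)) e i) j))

isOSASM≡good : ∀ {m} (A : Matrix m) → isOSASM A ≡ good (Vec.replicate m false) A
isOSASM≡good {m} A with isSymmetric A in eq
... | false = ∧-zeroʳ (isASM A)
... | true  = trans (cong (_∧ zeroDiagonal A) asm) (∧-comm (walks σ A) (zeroDiagonal A))
  where
  σ : Vec Bool m
  σ = Vec.replicate m false
  asm : isASM A ≡ walks σ A
  asm = trans (cong₂ _∧_ (walks-lines A) (trans (walks-lines (transpose A))
    (cong (walks σ) (transpose-symmetric A eq)))) (∧-idem (walks σ A))

norm : ∀ {m} → Vec ℤ m → ℕ
norm []      = 0
norm (x ∷ v) = ∣ x ∣ ℕ.+ norm v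

filterᵇ-map : ∀ (p : Y → Bool) (f : X → Y) xs → filterᵇ p (map f xs) ≡ map f (filterᵇ (p ∘ f) xs)
filterᵇ-map p f []       = refl
filterᵇ-map p f (x ∷ xs) with p (f x)
... | true  = cong (f x ∷_) (filterᵇ-map p f xs)
... | false = filterᵇ-map p f xs

filterᵇ-cong : ∀ {p q : X → Bool} xs → (∀ x → p x ≡ q x) → filterᵇ p xs ≡ filterᵇ q xs
filterᵇ-cong []       e = refl
filterᵇ-cong {p = p} {q} (x ∷ xs) e with p x | q x | e x
... | true  | true  | refl = cong (x ∷_) (filterᵇ-cong xs e)
... | false | false | refl = filterᵇ-cong xs e

filterᵇ-all : ∀ (xs : List X) → filterᵇ (const true) xs ≡ xs
filterᵇ-all []       = refl
filterᵇ-all (x ∷ xs) = cong (x ∷_) (filterᵇ-all xs)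

allFin-suc : ∀ m → allFin (suc m) ≡ zero ∷ map suc (allFin m)
allFin-suc m = cong (zero ∷_) (sym (map-tabulate id suc))

above : ∀ {m} → Fin m → Fin m → Bool
above i j = ⌊ toℕ i ℕ.<? toℕ j ⌋

upper : ∀ {m} → (Fin m → Fin m → ℕ) → Fin m → List ℕ
upper {m} e i = map (e i) (filterᵇ (above i) (allFin m))

above-suc : ∀ {m} (i j : Fin m) → above (suc i) (suc j) ≡ above i j
above-suc i j = trans (isYes≗does (suc (toℕ i) ℕ.<? suc (toℕ j))) (sym (isYes≗does (toℕ i ℕ.<? toℕ j)))

upper-zero : ∀ {m} (e : Fin (suc m) → Fin (suc m) → ℕ) → upper e zero ≡ map (e zero ∘ suc) (allFin m)
upper-zero {m} e = begin
  map (e zero) (filterᵇ (above zero) (allFin (suc m)))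
    ≡⟨ cong (λ js → map (e zero) (filterᵇ (above zero) js)) (allFin-suc m) ⟩
  map (e zero) (filterᵇ (above zero) (map suc (allFin m)))
    ≡⟨ cong (map (e zero)) (filterᵇ-map (above zero) suc (allFin m)) ⟩
  map (e zero) (map suc (filterᵇ (above zero ∘ suc) (allFin m)))
    ≡⟨ map-∘ (filterᵇ (above zero ∘ suc) (allFin m)) ⟨
  map (e zero ∘ suc) (filterᵇ (above zero ∘ suc) (allFin m))
    ≡⟨ cong (map (e zero ∘ suc)) (filterᵇ-all (allFin m)) ⟩
  map (e zero ∘ suc) (allFin m) ∎
  where open ≡-Reasoning

upper-suc : ∀ {m} (e : Fin (suc m) → Fin (suc m) → ℕ) i →
  upper e (suc i) ≡ upper (λ i j → e (suc i) (suc j)) i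
upper-suc {m} e i = begin
  map (e (suc i)) (filterᵇ (above (suc i)) (allFin (suc m)))
    ≡⟨ cong (λ js → map (e (suc i)) (filterᵇ (above (suc i)) js)) (allFin-suc m) ⟩
  map (e (suc i)) (filterᵇ (above (suc i)) (map suc (allFin m)))
    ≡⟨ cong (map (e (suc i))) (filterᵇ-map (above (suc i)) suc (allFin m)) ⟩
  map (e (suc i)) (map suc (filterᵇ (above (suc i) ∘ suc) (allFin m)))
    ≡⟨ map-∘ (filterᵇ (above (suc i) ∘ suc) (allFin m)) ⟨
  map (e (suc i) ∘ suc) (filterᵇ (above (suc i) ∘ suc) (allFin m))
    ≡⟨ cong (map (e (suc i) ∘ suc)) (filterᵇ-cong (allFin m) (above-suc i)) ⟩
  map (e (suc i) ∘ suc) (filterᵇ (above i) (allFin m)) ∎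
  where open ≡-Reasoning

sum-norm : ∀ {m} (v : Vec ℤ m) → sum (map (λ j → ∣ lookup v j ∣) (allFin m)) ≡ norm v
sum-norm []      = refl
sum-norm {suc m} (x ∷ v) = trans (cong (λ js → sum (map (λ j → ∣ lookup (x ∷ v) j ∣) js)) (allFin-suc m))
  (cong (∣ x ∣ ℕ.+_) (trans (cong sum (sym (map-∘ (allFin m)))) (sum-norm v)))

R-peel : ∀ {m} x v c (B : Matrix m) → R (peel x v c B) ≡ norm v ℕ.+ R B
R-peel {m} x v c B = begin
  sum (concatMap (upper e) (allFin (suc m)))
    ≡⟨ cong (sum ∘ concatMap (upper e)) (allFin-suc m) ⟩
  sum (upper e zero ++ concatMap (upper e) (map suc (allFin m)))
    ≡⟨ sum-++ (upper e zero) _ ⟩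
  sum (upper e zero) ℕ.+ sum (concatMap (upper e) (map suc (allFin m)))
    ≡⟨ cong₂ ℕ._+_ (trans (cong sum (upper-zero e)) (sum-norm v)) (cong sum (trans
         (concatMap-map (upper e) suc (allFin m))
         (concatMap-cong (λ i → trans (upper-suc e i)
           (map-cong (λ j → cong ∣_∣ (entry-inner x v c B i j))
             (filterᵇ (above i) (allFin m)))) (allFin m)))) ⟩
  norm v ℕ.+ R B ∎
  where
  open ≡-Reasoning
  e : Fin (suc m) → Fin (suc m) → ℕ
  e i j = ∣ entry (peel x v c B) i j ∣

-- Transfer of states and counting by the number of nonzero entries

through : ∀ {m} → Vec Bool m → Vec ℤ m → (Vec Bool m → ℤ) → ℤ
through []      []      K = K []
through (s ∷ σ) (x ∷ v) K = maybe (λ s′ → through σ v λ τ → K (s′ ∷ τ)) 0ℤ (step s x)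

through-cong : ∀ {m} (σ : Vec Bool m) v {K L} → (∀ τ → K τ ≡ L τ) → through σ v K ≡ through σ v L
through-cong []      []      e = e []
through-cong (s ∷ σ) (x ∷ v) e with step s x
... | just s′ = through-cong σ v λ τ → e (s′ ∷ τ)
... | nothing = refl

through-zero : ∀ {m} (σ : Vec Bool m) v → through σ v (const 0ℤ) ≡ 0ℤ
through-zero []      []      = refl
through-zero (s ∷ σ) (x ∷ v) with step s x
... | just s′ = through-zero σ v
... | nothing = refl

∑-through : ∀ {m} (xs : List X) (σ : Vec Bool m) v (K : X → Vec Bool m → ℤ) →
  ∑ xs (λ x → through σ v (K x)) ≡ through σ v (λ τ → ∑ xs (λ x → K x τ))
∑-through xs []      []      K = refl
∑-through xs (s ∷ σ) (y ∷ v) K with step s y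
... | just s′ = ∑-through xs σ v λ x τ → K x (s′ ∷ τ)
... | nothing = ∑-zero xs λ _ → refl

walks-through : ∀ {m k} (σ : Vec Bool m) v (B : Vec (Vec ℤ k) m) e →
  χ (walks σ (zipWith _∷_ v B)) * e ≡ through σ v (λ τ → χ (walks τ B) * e)
walks-through []      []      []      e = refl
walks-through (s ∷ σ) (x ∷ v) (r ∷ B) e with step s x
... | nothing = refl
... | just s′ = begin
  χ (walk s′ (toList r) ∧ walks σ (zipWith _∷_ v B)) * e
    ≡⟨ split (walk s′ (toList r)) (walks σ (zipWith _∷_ v B)) ⟩
  χ (walks σ (zipWith _∷_ v B)) * (χ (walk s′ (toList r)) * e)
    ≡⟨ walks-through σ v B (χ (walk s′ (toList r)) * e) ⟩
  through σ v (λ τ → χ (walks τ B) * (χ (walk s′ (toList r)) * e))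
    ≡⟨ through-cong σ v (λ τ → split (walk s′ (toList r)) (walks τ B)) ⟨
  through σ v (λ τ → χ (walk s′ (toList r) ∧ walks τ B) * e) ∎
  where
  open ≡-Reasoning
  split : ∀ b c → χ (b ∧ c) * e ≡ χ c * (χ b * e)
  split b c = trans (cong (_* e) (χ-∧ b c)) (lem (χ b) (χ c) e)
    where
    lem : ∀ u v w → u * v * w ≡ v * (u * w)
    lem = solve-∀

walk-zero : ∀ h l → walk h (0ℤ ∷ l) ≡ walk h l
walk-zero false l = refl
walk-zero true  l = refl

shifts : ℕ → Series → Series
shifts zero    g = g
shifts (suc a) g = shift (shifts a g)

shift-cong : ∀ {g g′} → (∀ j → g j ≡ g′ j) → ∀ j → shift g j ≡ shift g′ j
shift-cong e zero    = refl
shift-cong e (suc j) = e j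

shifts-cong : ∀ a {g g′} → (∀ j → g j ≡ g′ j) → ∀ j → shifts a g j ≡ shifts a g′ j
shifts-cong zero    e = e
shifts-cong (suc a) e = shift-cong (shifts-cong a e)

shift-* : ∀ c g j → c * shift g j ≡ shift (λ j → c * g j) j
shift-* c g zero    = *-zeroʳ c
shift-* c g (suc j) = refl

δ-+ : ∀ a r j → δ (a ℕ.+ r) j ≡ shifts a (δ r) j
δ-+ zero    r j = refl
δ-+ (suc a) r j = shift-cong (δ-+ a r) j

∑-shift : ∀ (xs : List X) (c : X → ℤ) (g : X → Series) j →
  ∑ xs (λ x → c x * shift (g x) j) ≡ shift (λ j → ∑ xs (λ x → c x * g x j)) j
∑-shift xs c g zero    = ∑-zero xs λ x → *-zeroʳ (c x)
∑-shift xs c g (suc j) = refl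

∑-shifts : ∀ a (xs : List X) (c : X → ℤ) (g : X → Series) j →
  ∑ xs (λ x → c x * shifts a (g x) j) ≡ shifts a (λ j → ∑ xs (λ x → c x * g x j)) j
∑-shifts zero    xs c g j = refl
∑-shifts (suc a) xs c g j = trans (∑-shift xs c (λ x → shifts a (g x)) j) (shift-cong (∑-shifts a xs c g) j)

∑-through-shift : ∀ {m} (σ : Vec Bool m) vs (u : Vec ℤ m → ℤ) (F : Vec ℤ m → Vec Bool m → Series) j →
  ∑ vs (λ v → u v * through σ v (λ τ → shift (F v τ) j)) ≡
  shift (λ j → ∑ vs (λ v → u v * through σ v (λ τ → F v τ j))) j
∑-through-shift σ vs u F zero    = ∑-zero vs λ v → trans (cong (u v *_) (through-zero σ v)) (*-zeroʳ (u v))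
∑-through-shift σ vs u F (suc j) = refl

count : ∀ m → Vec Bool m → Series
count m σ j = ∑ (allMatrices m) λ B → χ (good σ B) * δ (R B) j

good-peel : ∀ {m} h (σ : Vec Bool m) x v c B → χ (good (h ∷ σ) (peel x v c B)) ≡
  χ (eqv v c) * (χ (x == 0ℤ) * (χ (walk h (x ∷ toList v)) *
    (χ (walks σ (zipWith _∷_ c B)) * (χ (isSymmetric B) * χ (zeroDiagonal B)))))
good-peel h σ x v c B
  rewrite isSymmetric-peel x v c B | zeroDiagonal-peel x v c B
        | χ-∧ (eqv v c ∧ isSymmetric B)
            (((x == 0ℤ) ∧ zeroDiagonal B) ∧ (walk h (x ∷ toList v) ∧ walks σ (zipWith _∷_ c B)))
        | χ-∧ (eqv v c) (isSymmetric B)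
        | χ-∧ ((x == 0ℤ) ∧ zeroDiagonal B) (walk h (x ∷ toList v) ∧ walks σ (zipWith _∷_ c B))
        | χ-∧ (x == 0ℤ) (zeroDiagonal B)
        | χ-∧ (walk h (x ∷ toList v)) (walks σ (zipWith _∷_ c B)) =
  lem (χ (eqv v c)) (χ (isSymmetric B)) (χ (x == 0ℤ)) (χ (zeroDiagonal B))
    (χ (walk h (x ∷ toList v))) (χ (walks σ (zipWith _∷_ c B)))
  where
  lem : ∀ e s x z w ws → e * s * (x * z * (w * ws)) ≡ e * (x * (w * (ws * (s * z))))
  lem = solve-∀

χ-good : ∀ {m} (τ : Vec Bool m) B e →
  χ (walks τ B) * (χ (isSymmetric B) * χ (zeroDiagonal B) * e) ≡ χ (good τ B) * e
χ-good τ B e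
  rewrite χ-∧ (isSymmetric B) (zeroDiagonal B ∧ walks τ B) | χ-∧ (zeroDiagonal B) (walks τ B) =
  lem (χ (walks τ B)) (χ (isSymmetric B)) (χ (zeroDiagonal B)) e
  where
  lem : ∀ w s z e → w * (s * z * e) ≡ s * (z * w) * e
  lem = solve-∀

-- Symmetry makes the first column repeat the first row, the corner entry must be 0, and the rest is
-- counted from the states that the first column leaves. The weight `w` is arbitrary so that it can
-- be constant in `count≡Φ` and record the position of the 1 in `OSASM-sum`.
peel-sum : ∀ m h (σ : Vec Bool m) (w : Vec ℤ (suc m) → ℤ) j →
  ∑ (allMatrices (suc m)) (λ A → χ (good (h ∷ σ) A) * (w (Vec.head A) * δ (R A) j)) ≡
  ∑ (rowVecs m) (λ v → χ (walk h (toList v)) * w (0ℤ ∷ v) * through σ v (λ τ → shifts (norm v) (count m τ) j))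
peel-sum m h σ w j = begin
  ∑ (allMatrices (suc m)) f
    ≡⟨ ∑-vecs (rowVecs (suc m)) m f ⟩
  ∑ (rowVecs (suc m)) (λ r → ∑ (vecsOver (rowVecs (suc m)) m) (λ A → f (r ∷ A)))
    ≡⟨ ∑-vecs entries m (λ r → ∑ (vecsOver (rowVecs (suc m)) m) (λ A → f (r ∷ A))) ⟩
  ∑ entries (λ x → ∑ (rowVecs m) (λ v → ∑ (vecsOver (rowVecs (suc m)) m) (λ A → f ((x ∷ v) ∷ A))))
    ≡⟨ ∑-cong entries (λ x → ∑-cong (rowVecs m) (λ v → trans
         (∑-columns entries m m (λ A → f ((x ∷ v) ∷ A)))
         (∑-cong (rowVecs m) (λ c → trans (∑-cong (allMatrices m) (factor x v c))
           (∑-*ˡ (χ (eqv v c)) (allMatrices m) (Q x v c)))))) ⟩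
  ∑ entries (λ x → ∑ (rowVecs m) (λ v → ∑ (rowVecs m) (λ c → χ (eqv v c) * ∑ (allMatrices m) (Q x v c))))
    ≡⟨ ∑-cong entries (λ x → ∑-diagonal m (λ v c → ∑ (allMatrices m) (Q x v c))) ⟩
  ∑ entries (λ x → ∑ (rowVecs m) (λ v → ∑ (allMatrices m) (Q x v v)))
    ≡⟨ cong₂ _+_ (vanish -[1+ 0 ] refl) (cong (λ t → S 0ℤ + (t + 0ℤ)) (vanish 1ℤ refl)) ⟩
  0ℤ + (S 0ℤ + (0ℤ + 0ℤ))
    ≡⟨ trans (+-identityˡ _) (+-identityʳ (S 0ℤ)) ⟩
  S 0ℤ
    ≡⟨ ∑-cong (rowVecs m) inner ⟩
  ∑ (rowVecs m) (λ v → χ (walk h (toList v)) * w (0ℤ ∷ v) * through σ v (λ τ → shifts (norm v) (count m τ) j)) ∎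
  where
  open ≡-Reasoning
  f : Matrix (suc m) → ℤ
  f A = χ (good (h ∷ σ) A) * (w (Vec.head A) * δ (R A) j)
  P : Vec ℤ m → Matrix m → ℤ
  P v B = χ (isSymmetric B) * χ (zeroDiagonal B) * shifts (norm v) (δ (R B)) j
  Q : ℤ → Vec ℤ m → Vec ℤ m → Matrix m → ℤ
  Q x v c B = χ (x == 0ℤ) * (χ (walk h (x ∷ toList v)) * w (x ∷ v) * (χ (walks σ (zipWith _∷_ c B)) * P v B))
  S : ℤ → ℤ
  S x = ∑ (rowVecs m) (λ v → ∑ (allMatrices m) (Q x v v))
  factor : ∀ x v c B → f (peel x v c B) ≡ χ (eqv v c) * Q x v c B
  factor x v c B rewrite good-peel h σ x v c B | R-peel x v c B | δ-+ (norm v) (R B) j =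
    lem (χ (eqv v c)) (χ (x == 0ℤ)) (χ (walk h (x ∷ toList v))) (χ (walks σ (zipWith _∷_ c B)))
      (χ (isSymmetric B)) (χ (zeroDiagonal B)) (w (x ∷ v)) (shifts (norm v) (δ (R B)) j)
    where
    lem : ∀ e x w ws s z u d → e * (x * (w * (ws * (s * z)))) * (u * d) ≡ e * (x * (w * u * (ws * (s * z * d))))
    lem = solve-∀
  vanish : ∀ x → (x == 0ℤ) ≡ false → S x ≡ 0ℤ
  vanish x e = ∑-zero (rowVecs m) λ v → ∑-zero (allMatrices m) λ B →
    cong (λ b → χ b * (χ (walk h (x ∷ toList v)) * w (x ∷ v) * (χ (walks σ (zipWith _∷_ v B)) * P v B))) e
  inner : ∀ v → ∑ (allMatrices m) (Q 0ℤ v v) ≡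
    χ (walk h (toList v)) * w (0ℤ ∷ v) * through σ v (λ τ → shifts (norm v) (count m τ) j)
  inner v = begin
    ∑ (allMatrices m) (Q 0ℤ v v)
      ≡⟨ ∑-cong (allMatrices m) (λ B → trans
           (*-identityˡ (χ (walk h (0ℤ ∷ toList v)) * w (0ℤ ∷ v) * (χ (walks σ (zipWith _∷_ v B)) * P v B)))
           (cong (λ b → χ b * w (0ℤ ∷ v) * (χ (walks σ (zipWith _∷_ v B)) * P v B)) (walk-zero h (toList v)))) ⟩
    ∑ (allMatrices m) (λ B → c₀ * (χ (walks σ (zipWith _∷_ v B)) * P v B))
      ≡⟨ ∑-*ˡ c₀ (allMatrices m) (λ B → χ (walks σ (zipWith _∷_ v B)) * P v B) ⟩
    c₀ * ∑ (allMatrices m) (λ B → χ (walks σ (zipWith _∷_ v B)) * P v B)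
      ≡⟨ cong (c₀ *_) (∑-cong (allMatrices m) (λ B → walks-through σ v B (P v B))) ⟩
    c₀ * ∑ (allMatrices m) (λ B → through σ v (λ τ → χ (walks τ B) * P v B))
      ≡⟨ cong (c₀ *_) (∑-through (allMatrices m) σ v (λ B τ → χ (walks τ B) * P v B)) ⟩
    c₀ * through σ v (λ τ → ∑ (allMatrices m) (λ B → χ (walks τ B) * P v B))
      ≡⟨ cong (c₀ *_) (through-cong σ v (λ τ → trans
           (∑-cong (allMatrices m) (λ B → χ-good τ B (shifts (norm v) (δ (R B)) j)))
           (∑-shifts (norm v) (allMatrices m) (λ B → χ (good τ B)) (λ B → δ (R B)) j))) ⟩
    c₀ * through σ v (λ τ → shifts (norm v) (count m τ) j) ∎
    where
    c₀ : ℤ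
    c₀ = χ (walk h (toList v)) * w (0ℤ ∷ v)

-- Choosing the row entry by entry is letting its line cross the others: 0 is always admissible, and
-- a nonzero entry only at equal states, whose common value fixes its sign.
row-count : ∀ {m} h (σ : Vec Bool m) K j →
  ∑ (rowVecs m) (λ v → χ (walk h (toList v)) * through σ v (λ τ → shifts (norm v) (K (toList τ)) j)) ≡
  rowSeries h (toList σ) K j
row-count true  [] K j = trans (+-identityʳ (1ℤ * K [] j)) (*-identityˡ (K [] j))
row-count false [] K j = refl
row-count {suc m} h (s ∷ σ) K j = trans (∑-vecs entries m (summand h s)) (go h s)
  where
  summand : Bool → Bool → Vec ℤ (suc m) → ℤ
  summand h s v = χ (walk h (toList v)) * through (s ∷ σ) v (λ τ → shifts (norm v) (K (toList τ)) j)
  shifted : ∀ h s → ∑ (rowVecs m) (λ v → χ (walk h (toList v)) *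
    through σ v (λ τ → shift (shifts (norm v) (K (s ∷ toList τ))) j)) ≡
    shift (rowSeries h (toList σ) (K ∘ (s ∷_))) j
  shifted h s = trans
    (∑-through-shift σ (rowVecs m) (λ v → χ (walk h (toList v)))
      (λ v τ → shifts (norm v) (K (s ∷ toList τ))) j)
    (shift-cong (row-count h σ (K ∘ (s ∷_))) j)
  zero-walk : ∀ (F : Vec ℤ m → ℤ) → ∑ (rowVecs m) (λ v → 0ℤ * F v) ≡ 0ℤ
  zero-walk F = ∑-zero (rowVecs m) λ _ → refl
  zero-through : ∀ (u : Vec ℤ m → ℤ) → ∑ (rowVecs m) (λ v → u v * 0ℤ) ≡ 0ℤ
  zero-through u = ∑-zero (rowVecs m) λ v → *-zeroʳ (u v)
  go : ∀ h s → ∑ entries (λ x → ∑ (rowVecs m) (λ v → summand h s (x ∷ v))) ≡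
    rowSeries h (s ∷ toList σ) K j
  go false false = trans
    (cong₂ _+_ (zero-walk (λ _ → 0ℤ)) (cong₂ _+_ (row-count false σ (K ∘ (false ∷_)) j)
      (cong (_+ 0ℤ) (shifted true true))))
    (lem (rowSeries false (toList σ) (K ∘ (false ∷_)) j) (shift (rowSeries true (toList σ) (K ∘ (true ∷_))) j))
    where
    lem : ∀ u v → 0ℤ + (u + (v + 0ℤ)) ≡ u + v
    lem = solve-∀
  go false true  = trans
    (cong₂ _+_ (zero-walk (λ _ → 0ℤ)) (cong₂ _+_ (row-count false σ (K ∘ (true ∷_)) j)
      (cong (_+ 0ℤ) (zero-through (λ v → χ (walk true (toList v)))))))
    (lem _)
    where
    lem : ∀ u → 0ℤ + (u + (0ℤ + 0ℤ)) ≡ u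
    lem = solve-∀
  go true  false = trans
    (cong₂ _+_ (zero-through (λ v → χ (walk false (toList v)))) (cong₂ _+_
      (row-count true σ (K ∘ (false ∷_)) j) (cong (_+ 0ℤ) (zero-walk (λ _ → 0ℤ)))))
    (lem _)
    where
    lem : ∀ u → 0ℤ + (u + (0ℤ + 0ℤ)) ≡ u
    lem = solve-∀
  go true  true  = trans
    (cong₂ _+_ (shifted false false) (cong₂ _+_ (row-count true σ (K ∘ (true ∷_)) j)
      (cong (_+ 0ℤ) (zero-walk (λ _ → 0ℤ)))))
    (lem (shift (rowSeries false (toList σ) (K ∘ (false ∷_))) j) (rowSeries true (toList σ) (K ∘ (true ∷_)) j))
    where
    lem : ∀ u v → u + (v + (0ℤ + 0ℤ)) ≡ v + u
    lem = solve-∀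

count≡Φ : ∀ m (σ : Vec Bool m) j → count m σ j ≡ Φ m (toList σ) j
count≡Φ zero    []      j = trans (+-identityʳ (1ℤ * δ 0 j)) (*-identityˡ (δ 0 j))
count≡Φ (suc m) (h ∷ σ) j = begin
  count (suc m) (h ∷ σ) j
    ≡⟨ ∑-cong (allMatrices (suc m)) (λ A → cong (χ (good (h ∷ σ) A) *_) (sym (*-identityˡ (δ (R A) j)))) ⟩
  ∑ (allMatrices (suc m)) (λ A → χ (good (h ∷ σ) A) * (1ℤ * δ (R A) j))
    ≡⟨ peel-sum m h σ (const 1ℤ) j ⟩
  ∑ (rowVecs m) (λ v → χ (walk h (toList v)) * 1ℤ * through σ v (λ τ → shifts (norm v) (count m τ) j))
    ≡⟨ ∑-cong (rowVecs m) (λ v → cong₂ _*_ (*-identityʳ (χ (walk h (toList v))))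
         (through-cong σ v (λ τ → shifts-cong (norm v) (count≡Φ m τ) j))) ⟩
  ∑ (rowVecs m) (λ v → χ (walk h (toList v)) * through σ v (λ τ → shifts (norm v) (Φ m (toList τ)) j))
    ≡⟨ row-count h σ (Φ m) j ⟩
  Φ (suc m) (h ∷ toList σ) j ∎
  where open ≡-Reasoning

-- The first row and the position of its 1

falses : ∀ m → Vec Bool m
falses m = Vec.replicate m false

-- In state 1 the next nonzero entry would be -1, which a column in state 0 does not admit; so the
-- rest of the first row is zero.
after-one : ∀ m c (K : Vec Bool m → Series) j →
  ∑ (rowVecs m) (λ v → χ (walk true (toList v)) * c * through (falses m) v (λ τ → shifts (norm v) (K τ) j)) ≡
  c * K (falses m) j
after-one zero    c K j = lem c (K [] j)
  where
  lem : ∀ c k → 1ℤ * c * k + 0ℤ ≡ c * k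
  lem = solve-∀
after-one (suc m) c K j = trans (∑-vecs entries m summand) (trans
  (cong₂ _+_ (∑-zero (rowVecs m) λ v → *-zeroʳ (χ (walk false (toList v)) * c))
    (cong₂ _+_ (after-one m c (λ τ → K (false ∷ τ)) j) (cong (_+ 0ℤ) (∑-zero (rowVecs m) λ _ → refl))))
  (lem (c * K (falses (suc m)) j)))
  where
  summand : Vec ℤ (suc m) → ℤ
  summand v = χ (walk true (toList v)) * c * through (falses (suc m)) v (λ τ → shifts (norm v) (K τ) j)
  lem : ∀ u → 0ℤ + (u + (0ℤ + 0ℤ)) ≡ u
  lem = solve-∀

toList-falses : ∀ (rs : List X) → toList (falses (length rs)) ≡ zeros rs
toList-falses []       = refl
toList-falses (_ ∷ rs) = cong (false ∷_) (toList-falses rs)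

-- `ls` records the zeros passed so far. In the arguments of `g`, one successor counts the diagonal
-- entry, and the second one on the right counts the 1 itself, whose factor r is the `shift`.
top-row : ∀ (g : ℕ → ℤ) (Ψ : List Bool → Series) j (ls rs : List X) →
  ∑ (rowVecs (length rs)) (λ v → χ (walk false (toList v)) * g (suc (length ls ℕ.+ posOfOne (toList v))) *
    through (falses (length rs)) v (λ τ → shifts (norm v) (Ψ (zeros ls ʳ++ toList τ)) j)) ≡
  splits (λ ls y rs → g (suc (suc (length ls))) * shift (Ψ (mark ls rs)) j) ls rs
top-row g Ψ j ls []       = refl
top-row {X} g Ψ j ls (y ∷ rs) = trans (∑-vecs entries m summand) (trans
  (cong₂ _+_ (∑-zero (rowVecs m) λ _ → refl) (cong₂ _+_ later (cong (_+ 0ℤ) here)))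
  (lem (splits F (y ∷ ls) rs) (F ls y rs)))
  where
  m : ℕ
  m = length rs
  F : List X → X → List X → ℤ
  F ls y rs = g (suc (suc (length ls))) * shift (Ψ (mark ls rs)) j
  K : Bool → Vec Bool m → Series
  K s τ = Ψ (zeros ls ʳ++ s ∷ toList τ)
  summand : Vec ℤ (suc m) → ℤ
  summand v = χ (walk false (toList v)) * g (suc (length ls ℕ.+ posOfOne (toList v))) *
    through (falses (suc m)) v (λ τ → shifts (norm v) (Ψ (zeros ls ʳ++ toList τ)) j)
  later : ∑ (rowVecs m) (λ v → summand (0ℤ ∷ v)) ≡ splits F (y ∷ ls) rs
  later = trans
    (∑-cong (rowVecs m) (λ v → cong (λ t → χ (walk false (toList v)) * g (suc t) *
        through (falses m) v (λ τ → shifts (norm v) (K false τ) j))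
      (ℕ.+-suc (length ls) (posOfOne (toList v)))))
    (top-row g Ψ j (y ∷ ls) rs)
  c : ℤ
  c = g (suc (length ls ℕ.+ 1))
  here : ∑ (rowVecs m) (λ v → summand (1ℤ ∷ v)) ≡ F ls y rs
  here = begin
    ∑ (rowVecs m) (λ v → χ (walk true (toList v)) * c *
      through (falses m) v (λ τ → shift (shifts (norm v) (K true τ)) j))
      ≡⟨ ∑-through-shift (falses m) (rowVecs m) (λ v → χ (walk true (toList v)) * c)
           (λ v τ → shifts (norm v) (K true τ)) j ⟩
    shift (λ j → ∑ (rowVecs m) (λ v → χ (walk true (toList v)) * c *
      through (falses m) v (λ τ → shifts (norm v) (K true τ) j))) j
      ≡⟨ shift-cong (after-one m c (K true)) j ⟩
    shift (λ j → c * K true (falses m) j) j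
      ≡⟨ shift-* c (K true (falses m)) j ⟨
    c * shift (K true (falses m)) j
      ≡⟨ cong₂ (λ t σ → g (suc t) * shift (Ψ (zeros ls ʳ++ true ∷ σ)) j)
           (ℕ.+-comm (length ls) 1) (toList-falses rs) ⟩
    F ls y rs ∎
    where open ≡-Reasoning
  lem : ∀ u v → 0ℤ + (u + (v + 0ℤ)) ≡ v + u
  lem = solve-∀

T-head : ∀ {m} (A : Matrix (suc m)) → T A ≡ posOfOne (toList (Vec.head A))
T-head (r ∷ A) = refl

OSASM-sum : ∀ (xs : List X) (g : ℕ → ℤ) j →
  ∑ (allMatrices (suc (length xs))) (λ A → χ (isOSASM A) * (g (T A) * δ (R A) j)) ≡
  splits (λ ls y rs → g (suc (suc (length ls))) * shift (Φ (length xs) (mark ls rs)) j) [] xs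
OSASM-sum xs g j = begin
  ∑ (allMatrices (suc m)) (λ A → χ (isOSASM A) * (g (T A) * δ (R A) j))
    ≡⟨ ∑-cong (allMatrices (suc m)) (λ A → cong₂ (λ b t → χ b * (g t * δ (R A) j))
         (isOSASM≡good A) (T-head A)) ⟩
  ∑ (allMatrices (suc m)) (λ A → χ (good (false ∷ falses m) A) * (w (Vec.head A) * δ (R A) j))
    ≡⟨ peel-sum m false (falses m) w j ⟩
  ∑ (rowVecs m) (λ v → χ (walk false (toList v)) * w (0ℤ ∷ v) *
    through (falses m) v (λ τ → shifts (norm v) (count m τ) j))
    ≡⟨ ∑-cong (rowVecs m) (λ v → cong (χ (walk false (toList v)) * w (0ℤ ∷ v) *_)
         (through-cong (falses m) v (λ τ → shifts-cong (norm v) (count≡Φ m τ) j))) ⟩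
  ∑ (rowVecs m) (λ v → χ (walk false (toList v)) * w (0ℤ ∷ v) *
    through (falses m) v (λ τ → shifts (norm v) (Φ m (toList τ)) j))
    ≡⟨ top-row g (Φ m) j [] xs ⟩
  splits (λ ls y rs → g (suc (suc (length ls))) * shift (Φ m (mark ls rs)) j) [] xs ∎
  where
  open ≡-Reasoning
  m : ℕ
  m = length xs
  w : Vec ℤ (suc m) → ℤ
  w r = g (posOfOne (toList r))

-- Coefficients of the generating function and their reflection

χ-δ : ∀ r j → χ ((+ r) == (+ j)) ≡ δ r j
χ-δ zero    zero    = refl
χ-δ zero    (suc j) = refl
χ-δ (suc r) zero    = refl
χ-δ (suc r) (suc j) = trans
  (cong χ (==-cong (λ e → cong +_ (ℕ.suc-injective (+-injective e)))
    (λ e → cong (λ i → + suc i) (+-injective e))))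
  (χ-δ r j)

XO-sum : ∀ m a k → XO m a k ≡
  ∑ (allMatrices m) (λ A → χ (isOSASM A) * (χ ((+ T A) == k) * χ ((+ R A) == a)))
XO-sum m a k = trans (length-filterᵇ _ (OSASMs m)) (trans (∑-filterᵇ isOSASM (allMatrices m) _)
  (∑-cong (allMatrices m) λ A → cong (χ (isOSASM A) *_)
    (trans (χ-∧ ((+ R A) == a) ((+ T A) == k)) (*-comm (χ ((+ R A) == a)) (χ ((+ T A) == k))))))

XO-negative : ∀ m i k → XO m -[1+ i ] k ≡ 0ℤ
XO-negative m i k = trans (XO-sum m -[1+ i ] k) (∑-zero (allMatrices m) λ A →
  trans (cong (χ (isOSASM A) *_) (*-zeroʳ (χ ((+ T A) == k)))) (*-zeroʳ (χ (isOSASM A))))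

XO-splits : ∀ (xs : List X) j k → XO (suc (length xs)) (+ j) k ≡
  splits (λ ls y rs → χ ((+ suc (suc (length ls))) == k) * shift (Φ (length xs) (mark ls rs)) j) [] xs
XO-splits xs j k = trans (XO-sum (suc (length xs)) (+ j) k) (trans
  (∑-cong (allMatrices (suc (length xs))) λ A →
    cong (λ t → χ (isOSASM A) * (χ ((+ T A) == k) * t)) (χ-δ (R A) j))
  (OSASM-sum xs (λ t → χ ((+ t) == k)) j))

-- With `l` lines before the marked one and `r` after it, the order of the matrix is `l + r + 2`,
-- and the two positions `l + 2` and `r + 2` add up to the order plus 2.
reflected-position : ∀ l r k →
  ((+ suc (suc r)) == k) ≡ ((+ suc (suc l)) == (- (k - + (suc (suc (l ℕ.+ r)) ℕ.+ 2))))
reflected-position l r k = ==-cong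
  (to (+ suc (suc l)) (+ suc (suc r)) k total)
  (from (+ suc (suc l)) (+ suc (suc r)) k total)
  where
  total : + (suc (suc (l ℕ.+ r)) ℕ.+ 2) ≡ + suc (suc l) + + suc (suc r)
  total = cong (λ i → + suc (suc i)) (trans (ℕ.+-assoc l r 2) (cong (l ℕ.+_) (ℕ.+-comm r 2)))
  to : ∀ u v k {s} → s ≡ u + v → v ≡ k → u ≡ - (k - s)
  to u v k refl refl = lem u v
    where
    lem : ∀ u v → u ≡ - (v - (u + v))
    lem = solve-∀
  from : ∀ u v k {s} → s ≡ u + v → u ≡ - (k - s) → v ≡ k
  from u v k refl e = linear-combination -1ℤ e (lem u v k)
    where
    lem : ∀ u v k → v ≡ k + -1ℤ * (u - - (k - (u + v)))
    lem = solve-∀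

-- Reversing the sum over the position of the 1 exchanges `ls` and `rs`. `Φ-mark` restores the
-- series in r, so only the exponent of t is reflected.
XO-reflect : ∀ m a k → XO (suc m) a k ≡ XO (suc m) a (- (k - + (suc m ℕ.+ 2)))
XO-reflect m -[1+ i ] k = trans (XO-negative (suc m) i k) (sym (XO-negative (suc m) i (- (k - + (suc m ℕ.+ 2)))))
XO-reflect m (+ j)    k = begin
  XO (suc m) (+ j) k
    ≡⟨ cong (λ n → XO (suc n) (+ j) k) size-reverse ⟨
  XO (suc (length (reverse xs))) (+ j) k
    ≡⟨ XO-splits (reverse xs) j k ⟩
  splits (F (length (reverse xs))) [] (reverse xs)
    ≡⟨ cong (λ n → splits (F n) [] (reverse xs)) size-reverse ⟩
  splits (F m) [] (reverse xs)
    ≡⟨ splits-reverse (λ ls y rs → F m rs y ls) xs ⟨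
  splits (λ ls y rs → F m rs y ls) [] xs
    ≡⟨ splits-cong [] xs reflect ⟩
  splits (F′ m) [] xs
    ≡⟨ cong (λ n → splits (F′ n) [] xs) size ⟨
  splits (F′ (length xs)) [] xs
    ≡⟨ XO-splits xs j k′ ⟨
  XO (suc (length xs)) (+ j) k′
    ≡⟨ cong (λ n → XO (suc n) (+ j) k′) size ⟩
  XO (suc m) (+ j) k′ ∎
  where
  open ≡-Reasoning
  k′ : ℤ
  k′ = - (k - + (suc m ℕ.+ 2))
  xs : List ℕ
  -- Distinct labels for the lines other than the first, as `Φ-mark` requires.
  xs = upTo m
  size : length xs ≡ m
  size = length-upTo m
  size-reverse : length (reverse xs) ≡ m
  size-reverse = trans (length-reverse xs) size
  F F′ : ℕ → List ℕ → ℕ → List ℕ → ℤ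
  F  n ls y rs = χ ((+ suc (suc (length ls))) == k) * shift (Φ n (mark ls rs)) j
  F′ n ls y rs = χ ((+ suc (suc (length ls))) == k′) * shift (Φ n (mark ls rs)) j
  reflect : ∀ ls y rs → ls ʳ++ y ∷ rs ≡ xs → F m rs y ls ≡ F′ m ls y rs
  reflect ls y rs e = cong₂ _*_
    (cong χ (subst
      (λ n → ((+ suc (suc (length rs))) == k) ≡
        ((+ suc (suc (length ls))) == (- (k - + (suc n ℕ.+ 2)))))
      (sym total) (reflected-position (length ls) (length rs) k)))
    (shift-cong (λ i → sym (Φ-mark m ls y rs (subst (AllPairs _≢_) (sym e) (upTo⁺ m))
      (trans total (sym (length-mark ls rs))) i)) j)
    where
    total : m ≡ suc (length ls ℕ.+ length rs)
    total = trans (sym size) (trans (cong length (sym e))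
      (trans (length-ʳ++ ls) (ℕ.+-suc (length ls) (length rs))))

theorem5p1 : (n : ℕ) → 1 ℕ.≤ n → (a k : ℤ) →
    XO (2 ℕ.* n) a k ≡ mulTPow (2 ℕ.* n ℕ.+ 2) (invT (XO (2 ℕ.* n))) a k
theorem5p1 (suc n) _ a k = XO-reflect (n ℕ.+ suc (n ℕ.+ 0)) a k
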